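{- For any monotone tree poset $T$ and $\varepsilon>0$, there exist $\delta>0$ and $n_0$ such that for any $n\ge n_0$, any family $\mathcal F\subseteq 2^{[n]}$ of size $|\mathcal F|\ge (h(T)-1+\varepsilon)\binom{n}{\lfloor n/2\rfloor}$ contains at least $\delta n^{x(T)}\binom{n}{\lfloor n/2\rfloor}$ copies of $T$.
   Context: For a finite poset $(P,\le)$ and $\mathcal F\subseteq 2^{[n]}$, a (non-induced) copy of $P$ in $\mathcal F$ is a subfamily $\mathcal G\subseteq \mathcal F$ with a bijection $i:P\to\mathcal G$ such that $p\le q$ implies $i(p)\subseteq i(q)$; $\mathcal F$ is $P$-free if it contains no copy of $P$. The Hasse diagram of $P$ has an arc $pq$ whenever $p<q$ and no $z$ satisfies $p<z<q$ (write $p\prec q$). $P$ is a tree poset if its undirected Hasse diagram is a tree. A tree poset $T$ is upward (downward) monotone if every $x\in T$ has at most one $y\in T$ with $y\prec x$ (with $x\prec y$); $T$ is monotone if it is upward or downward monotone. $h(T)$ is the height of $T$, the maximum number of elements of a chain in $T$. $e(P)$ is the largest integer $m$ such that for every $n$ and every $i$, the family $\binom{[n]}{i+1}\cup\dots\cup\binom{[n]}{i+m}$ is $P$-free. The $k$ middle levels of $2^{[n]}$ are the levels $\binom{[n]}{j}$ with $\lfloor (n-k)/2\rfloor+1\le j\le \lfloor (n-k)/2\rfloor+k$. $x(P)$ is the maximum, over all copies $\mathcal G$ of $P$ all of whose sets lie in the $e(P)+1$ middle levels of $2^{[n]}$, of $|\bigcup_{G\in\mathcal G}G|-|\bigcap_{G\in\mathcal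 G}G|$ (for $n$ sufficiently large; this value does not depend on $n$). -}

module Defs where

open import Level using (0ℓ)
open import Data.Nat as ℕ using (ℕ; zero; suc; _+_; _∸_; _≤_; _<_; ⌊_/2⌋; _≤ᵇ_)
open import Data.Bool using (Bool; true; false; _∧_)
open import Data.Fin using (Fin; zero; suc; inject₁; fromℕ)
open import Data.Fin.Subset using (Subset; _⊆_; ∣_∣; ⋃; ⋂)
open import Data.Vec using ([]; _∷_)
open import Data.List using (List; []; _∷_; _++_; map; length; filter; tabulate)
open import Data.Product using (Σ; ∃; _×_; _,_)
open import Data.Sum using (_⊎_)
open import Data.Integer using (+_)
open import Data.Rational using (ℚ; _/_)
open import Relation.Nullary using (¬_)
open import Relation.Binary using (IsPartialOrder)
open import Relation.Binary.PropositionalEquality using (_≡_; _≢_)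
open import Relation.Binary.Construct.Closure.ReflexiveTransitive using (Star)
open import Function.Definitions using (Injective)

ℕ→ℚ : ℕ → ℚ
ℕ→ℚ m = + m / 1

IsLargest : (ℕ → Set) → ℕ → Set
IsLargest Q m = Q m × (∀ m′ → Q m′ → m′ ≤ m)

record FinPoset : Set₁ where
  field
    size           : ℕ
    _≼_            : Fin size → Fin size → Set
    isPartialOrder : IsPartialOrder _≡_ _≼_

module _ (P : FinPoset) where
  open FinPoset P

  _≺ₛ_ : Fin size → Fin size → Set
  p ≺ₛ q = p ≼ q × p ≢ q

  Covers : Fin size → Fin size → Set
  Covers p q = p ≺ₛ q × ¬ (∃ λ z → p ≺ₛ z × z ≺ₛ q)

  HasseAdj : Fin size → Fin size → Set
  HasseAdj p q = Covers p q ⊎ Covers q p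

  HasseConnected : Set
  HasseConnected = ∀ p q → Star HasseAdj p q

  HasseCycle : (m : ℕ) → (Fin (suc (suc (suc m))) → Fin size) → Set
  HasseCycle m c =
    Injective _≡_ _≡_ c
    × (∀ (i : Fin (suc (suc m))) → HasseAdj (c (inject₁ i)) (c (suc i)))
    × HasseAdj (c (fromℕ (suc (suc m)))) (c zero)

  HasseAcyclic : Set
  HasseAcyclic = ∀ m c → ¬ HasseCycle m c

  IsTreePoset : Set
  IsTreePoset = 0 < size × HasseConnected × HasseAcyclic

  UpwardMonotone : Set
  UpwardMonotone = ∀ x y y′ → Covers y x → Covers y′ x → y ≡ y′

  DownwardMonotone : Set
  DownwardMonotone = ∀ x y y′ → Covers x y → Covers x y′ → y ≡ y′

  Monotone : Set
  Monotone = UpwardMonotone ⊎ DownwardMonotone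

  IsChain : (m : ℕ) → (Fin m → Fin size) → Set
  IsChain m c = Injective _≡_ _≡_ c × (∀ i j → c i ≼ c j ⊎ c j ≼ c i)

  IsHeight : ℕ → Set
  IsHeight = IsLargest (λ m → ∃ λ c → IsChain m c)

Family : ℕ → Set
Family n = Subset n → Bool

allSets : (n : ℕ) → List (Subset n)
allSets zero    = [] ∷ []
allSets (suc n) = map (true ∷_) (allSets n) ++ map (false ∷_) (allSets n)

card : ∀ {n} → Family n → ℕ
card {n} F = length (filter (λ s → Data.Bool._≟_ (F s) true) (allSets n))

levels : (n i m : ℕ) → Family n
levels n i m s = (suc i ≤ᵇ ∣ s ∣) ∧ (∣ s ∣ ≤ᵇ i + m)

middleLevels : (n k : ℕ) → Family n
middleLevels n k = levels n ⌊ n ∸ k /2⌋ k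

module _ (P : FinPoset) where
  open FinPoset P

  -- a copy of P in F, given by the bijection i : P → 𝒢 (injective map with image 𝒢 ⊆ F)
  record Copy {n : ℕ} (F : Family n) : Set where
    field
      emb       : Fin size → Subset n
      injective : Injective _≡_ _≡_ emb
      monotone  : ∀ p q → p ≼ q → emb p ⊆ emb q
      inFamily  : ∀ p → F (emb p) ≡ true
  open Copy public

  SameSubfamily : ∀ {n} {F : Family n} → Copy F → Copy F → Set
  SameSubfamily c d =
    (∀ p → ∃ λ q → emb c p ≡ emb d q) × (∀ q → ∃ λ p → emb d q ≡ emb c p)

  AtLeastCopies : ∀ {n} → Family n → ℕ → Set
  AtLeastCopies F M =
    Σ (Fin M → Copy F) λ cs → ∀ a b → a ≢ b → ¬ SameSubfamily (cs a) (cs b)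

  Free : ∀ {n} → Family n → Set
  Free F = ¬ Copy F

  IsE : ℕ → Set
  IsE = IsLargest (λ m → ∀ n i → Free (levels n i m))

  spread : ∀ {n} {F : Family n} → Copy F → ℕ
  spread c = ∣ ⋃ (tabulate (emb c)) ∣ ∸ ∣ ⋂ (tabulate (emb c)) ∣

  IsX : ℕ → ℕ → Set
  IsX e x = ∃ λ n₀ → ∀ n → n₀ ≤ n →
    IsLargest (λ v → Σ (Copy (middleLevels n (suc e))) λ c → spread c ≡ v) x

-- For T upward monotone, that is, a tree rooted at its minimum.  Call F ∈ G rich if a random maximal chain
-- going up from F meets G again with probability at least 1/b.  A random maximal chain meets the non-rich
-- members at most 1/(1 - 1/b) times on average, so they number barely more than one middle level.  Passing
-- to the rich members h - 1 times therefore leaves a positive proportion of a middle level.  A set that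
-- survives g more rounds than required sees a member of the remaining family at distance at least g above
-- it with probability at least b^-g, hence, away from the top of the cube, order n^g such members.
-- Take a copy of T of spread x in e + 1 ≤ h consecutive levels as a model.  Embedding T from the root
-- upwards, with each vertex in the round given by its level in the model, there are order n^g choices for a
-- vertex g levels above its parent, and these g add up to at least x.  Each subfamily arises boundedly often.
-- The downward monotone case follows by complementation.
-- Rational averages are avoided throughout by counting maximal chains.
module Submission where

open import Defs
open import Data.Bool as Bool using (Bool; true; false; _∧_; if_then_else_; T; not)
import Data.Bool.Properties as Bool
open import Data.Empty using (⊥-elim)
open import Data.Fin as Fin using (Fin; zero; suc)
import Data.Fin.Properties as Fin
open import Data.Fin.Subset using (Subset; ∣_∣; ⊥; _⊆_; _∪_; ∁; ⁅_⁆; ⋃; ⋂; _∈_)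
open import Data.Fin.Subset.Properties hiding (_∈?_)
import Data.Integer as ℤ
import Data.Integer.Properties as ℤ
open import Data.List as List using (List)
open import Data.List.Membership.Propositional using (_∉_) renaming (_∈_ to _∈ₗ_)
import Data.List.Membership.DecPropositional as DecMembership
open import Data.List.Membership.Propositional.Properties using (∈-allFin; ∈-lookup; ∈-map⁻; ∈-++⁻; ∈-filter⁻; ∈-cartesianProductWith⁺)
open import Data.List.Properties using (length-++; length-map; filter-++)
open import Data.List.Relation.Unary.All as All using (All)
open import Data.List.Relation.Unary.All.Properties using (tabulate⁺)
open import Data.List.Relation.Unary.AllPairs as AllPairs using (AllPairs)
open import Data.List.Relation.Unary.Any as Any using (here; there)
open import Data.List.Relation.Unary.Any.Properties using (lookup-index)
open import Data.List.Relation.Unary.Unique.Propositional using (Unique)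
import Data.List.Relation.Unary.Unique.Propositional.Properties as Unique
import Data.Nat as ℕ
open import Data.Nat.Combinatorics using (_C_; k![n∸k]!∣n!; nCk≡n!/k![n-k]!; nCk+nC[k+1]≡[n+1]C[k+1])
open import Data.Nat.DivMod using (_/_; _%_; m≡m%n+[m/n]*n; m%n<n; m/n*n≡m; m*n/n≡m; /-monoˡ-≤)
import Data.Nat.Properties as ℕ
open import Data.Nat.Tactic.RingSolver using (solve-∀)
open import Data.Product using (Σ; ∃; ∃₂; _×_; _,_; proj₁; proj₂)
import Data.Rational as ℚ
import Data.Rational.Properties as ℚ
import Data.Rational.Unnormalised as ℚᵘ
import Data.Rational.Unnormalised.Properties as ℚᵘ
open import Data.Sum as Sum using (_⊎_; inj₁; inj₂)
open import Data.Unit using (tt)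
open import Data.Vec as Vec using (Vec; []; _∷_; lookup)
import Data.Vec.Properties as Vec
open import Function using (_∘_; flip; id)
open import Function.Definitions using (Injective)
open import Relation.Binary using (IsPartialOrder; DecidableEquality; tri<; tri≈; tri>)
import Relation.Binary.Construct.Flip.EqAndOrd as Flip
open import Relation.Binary.PropositionalEquality hiding (isPartialOrder)
open import Relation.Nullary using (¬_; yes; no)
open import Relation.Nullary.Decidable using (decidable-stable; toWitness; ¬?)

-- Why distance turns into a power of n: a set H at least g levels above F, with at least r elements
-- missing, lies on at most a share `g ! / r ^ g` of the maximal chains going up from F. A share
-- `1 / b ^ g` of these chains can therefore be covered only by order `r ^ g` such sets. The
-- estimate degenerates when r is small, so sets with fewer than n/16 missing elements are deleted
-- beforehand; they are too few to matter. Why the jumps of the model reach x: every set of the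
-- model contains the set of the root, and a vertex g levels above its parent contributes at most g
-- elements to a union that already contains the set of the parent. Hence the sum of the g bounds
-- the size of the union minus that of the intersection. Why e + 1 ≤ h: the principal downsets of an
-- upward monotone T form a copy of T in h consecutive levels, so h levels are not T-free. The h - 1
-- rounds therefore suffice for all levels of the model.

module Counting where
  open import Data.Nat
  open import Data.Nat.Properties
  open import Relation.Binary.Construct.Closure.ReflexiveTransitive as Star using (Star; ε; _◅_; _◅◅_)

  -- Sums over the cube

  ⟦_⟧ : Bool → ℕ
  ⟦ true ⟧ = 1
  ⟦ false ⟧ = 0

  co : ∀ {n} → Subset n → ℕ
  co []          = 0
  co (true ∷ F)  = co F
  co (false ∷ F) = suc (co F)

  ∣F∣+co : ∀ {n} (F : Subset n) → ∣ F ∣ + co F ≡ n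
  ∣F∣+co []          = refl
  ∣F∣+co (true ∷ F)  = cong suc (∣F∣+co F)
  ∣F∣+co (false ∷ F) = trans (+-suc ∣ F ∣ (co F)) (cong suc (∣F∣+co F))

  ∑ : ∀ {n} → (Subset n → ℕ) → ℕ
  ∑ {zero}  f = f []
  ∑ {suc n} f = ∑ (f ∘ (true ∷_)) + ∑ (f ∘ (false ∷_))

  ∑-mono : ∀ {n} {f g : Subset n → ℕ} → (∀ F → f F ≤ g F) → ∑ f ≤ ∑ g
  ∑-mono {zero}  f≤g = f≤g []
  ∑-mono {suc n} f≤g = +-mono-≤ (∑-mono (f≤g ∘ (true ∷_))) (∑-mono (f≤g ∘ (false ∷_)))

  ∑-cong : ∀ {n} {f g : Subset n → ℕ} → (∀ F → f F ≡ g F) → ∑ f ≡ ∑ g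
  ∑-cong {zero}  f≡g = f≡g []
  ∑-cong {suc n} f≡g = cong₂ _+_ (∑-cong (f≡g ∘ (true ∷_))) (∑-cong (f≡g ∘ (false ∷_)))

  interchange : ∀ a b c d → (a + b) + (c + d) ≡ (a + c) + (b + d)
  interchange = solve-∀

  ∑-+ : ∀ {n} (f g : Subset n → ℕ) → ∑ (λ F → f F + g F) ≡ ∑ f + ∑ g
  ∑-+ {zero}  f g = refl
  ∑-+ {suc n} f g = trans
    (cong₂ _+_ (∑-+ (f ∘ (true ∷_)) (g ∘ (true ∷_))) (∑-+ (f ∘ (false ∷_)) (g ∘ (false ∷_))))
    (interchange (∑ (f ∘ (true ∷_))) _ _ _)

  ∑-* : ∀ {n} c (f : Subset n → ℕ) → ∑ (λ F → c * f F) ≡ c * ∑ f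
  ∑-* {zero}  c f = refl
  ∑-* {suc n} c f = trans
    (cong₂ _+_ (∑-* c (f ∘ (true ∷_))) (∑-* c (f ∘ (false ∷_))))
    (sym (*-distribˡ-+ c (∑ (f ∘ (true ∷_))) _))

  term≤∑ : ∀ {n} (f : Subset n → ℕ) F → f F ≤ ∑ f
  term≤∑ f []          = ≤-refl
  term≤∑ f (true ∷ F)  = ≤-trans (term≤∑ (f ∘ (true ∷_)) F) (m≤m+n _ _)
  term≤∑ f (false ∷ F) = ≤-trans (term≤∑ (f ∘ (false ∷_)) F) (m≤n+m _ _)

  ∑≤⊥+∑ : ∀ {n} {f g : Subset n → ℕ} → (∀ F → 0 < ∣ F ∣ → f F ≤ g F) → ∑ f ≤ f ⊥ + ∑ g
  ∑≤⊥+∑ {zero}  {f} {g} f≤g = m≤m+n (f []) (g [])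
  ∑≤⊥+∑ {suc n} {f} {g} f≤g = begin
    ∑ (f ∘ (true ∷_)) + ∑ (f ∘ (false ∷_))
      ≤⟨ +-mono-≤ (∑-mono (λ F → f≤g (true ∷ F) z<s)) (∑≤⊥+∑ (λ F → f≤g (false ∷ F))) ⟩
    ∑ (g ∘ (true ∷_)) + (f ⊥ + ∑ (g ∘ (false ∷_)))
      ≡⟨ rearrange (∑ (g ∘ (true ∷_))) (f ⊥) _ ⟩
    f ⊥ + (∑ (g ∘ (true ∷_)) + ∑ (g ∘ (false ∷_))) ∎
    where
    open ≤-Reasoning
    rearrange : ∀ a b c → a + (b + c) ≡ b + (a + c)
    rearrange = solve-∀

  -- The sum of `f` over the upper covers of a set, which arise by adding one of its `co F` missing
  -- elements. Iterating it walks up the maximal chains.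
  S : ∀ {n} → (Subset n → ℕ) → Subset n → ℕ
  S f []          = 0
  S f (true ∷ F)  = S (f ∘ (true ∷_)) F
  S f (false ∷ F) = f (true ∷ F) + S (f ∘ (false ∷_)) F

  S-mono : ∀ {n} {f g : Subset n → ℕ} F → (∀ K → suc (co K) ≡ co F → f K ≤ g K) → S f F ≤ S g F
  S-mono []          f≤g = z≤n
  S-mono (true ∷ F)  f≤g = S-mono F (λ K → f≤g (true ∷ K))
  S-mono (false ∷ F) f≤g = +-mono-≤ (f≤g (true ∷ F) refl) (S-mono F (λ K → f≤g (false ∷ K) ∘ cong suc))

  S-cong : ∀ {n} {f g : Subset n → ℕ} F → (∀ K → suc (co K) ≡ co F → f K ≡ g K) → S f F ≡ S g F
  S-cong F f≡g = ≤-antisym (S-mono F (λ K p → ≤-reflexive (f≡g K p)))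
                           (S-mono F (λ K p → ≤-reflexive (sym (f≡g K p))))

  S-* : ∀ {n} c (f : Subset n → ℕ) F → S (λ K → c * f K) F ≡ c * S f F
  S-* c f []          = sym (*-zeroʳ c)
  S-* c f (true ∷ F)  = S-* c (f ∘ (true ∷_)) F
  S-* c f (false ∷ F) = trans (cong (c * f (true ∷ F) +_) (S-* c (f ∘ (false ∷_)) F))
                              (sym (*-distribˡ-+ c (f (true ∷ F)) _))

  S-const : ∀ {n} {f : Subset n → ℕ} {c} F → (∀ K → suc (co K) ≡ co F → f K ≤ c) → S f F ≤ co F * c
  S-const []          f≤c = z≤n
  S-const (true ∷ F)  f≤c = S-const F (λ K → f≤c (true ∷ K))
  S-const (false ∷ F) f≤c = +-mono-≤ (f≤c (true ∷ F) refl) (S-const F (λ K → f≤c (false ∷ K) ∘ cong suc))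

  S-∑ : ∀ {m n} (φ : Subset m → Subset n → ℕ) F →
        S (λ K → ∑ (λ H → φ H K)) F ≡ ∑ (λ H → S (φ H) F)
  S-∑ φ []          = sym (∑-* 0 (λ H → φ H []))
  S-∑ φ (true ∷ F)  = S-∑ (λ H → φ H ∘ (true ∷_)) F
  S-∑ φ (false ∷ F) = trans (cong (∑ (λ H → φ H (true ∷ F)) +_) (S-∑ (λ H → φ H ∘ (false ∷_)) F))
                            (sym (∑-+ (λ H → φ H (true ∷ F)) _))

  -- Double counting of covering pairs: a set has as many lower covers as elements.
  ∑-S : ∀ {n} (f : Subset n → ℕ) → ∑ (S f) ≡ ∑ (λ F → ∣ F ∣ * f F)
  ∑-S {zero}  f = refl
  ∑-S {suc n} f = begin
    ∑ (S fₜ) + ∑ (λ F → fₜ F + S fₒ F)  ≡⟨ cong₂ _+_ (∑-S fₜ) (trans (∑-+ fₜ (S fₒ)) (cong (∑ fₜ +_) (∑-S fₒ))) ⟩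
    ∑ (λ F → ∣ F ∣ * fₜ F) + (∑ fₜ + Z)   ≡⟨ rearrange (∑ (λ F → ∣ F ∣ * fₜ F)) (∑ fₜ) Z ⟩
    (∑ fₜ + ∑ (λ F → ∣ F ∣ * fₜ F)) + Z   ≡⟨ cong (_+ Z) (sym (∑-+ fₜ (λ F → ∣ F ∣ * fₜ F))) ⟩
    ∑ (λ F → suc ∣ F ∣ * fₜ F) + Z ∎
    where
    open ≡-Reasoning
    fₜ fₒ : Subset n → ℕ
    fₜ = f ∘ (true ∷_)
    fₒ = f ∘ (false ∷_)
    Z = ∑ (λ F → ∣ F ∣ * fₒ F)
    rearrange : ∀ a b c → a + (b + c) ≡ (b + a) + c
    rearrange = solve-∀

  -- The weight `∣ F ∣ !` is the number of maximal chains from the empty set to F. Splitting these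
  -- chains by their last step moves the weight of a nonempty set to its lower covers, and only the
  -- empty set is left over.
  ∑-weighted : ∀ {n} (g : Subset n → ℕ) →
               ∑ (λ F → ∣ F ∣ ! * g F) ≤ ∣ ⊥ {n} ∣ ! * g ⊥ + ∑ (λ F → ∣ F ∣ ! * S g F)
  ∑-weighted {n} g = begin
    ∑ (λ F → ∣ F ∣ ! * g F)
      ≤⟨ ∑≤⊥+∑ {g = λ F → ∣ F ∣ * (pred ∣ F ∣ ! * g F)} shift ⟩
    Z + ∑ (λ F → ∣ F ∣ * (pred ∣ F ∣ ! * g F))
      ≡⟨ cong (Z +_) (sym (∑-S (λ F → pred ∣ F ∣ ! * g F))) ⟩
    Z + ∑ (S (λ F → pred ∣ F ∣ ! * g F))
      ≡⟨ cong (Z +_) (∑-cong (λ F → trans (S-cong F (λ K → size F K)) (S-* (∣ F ∣ !) g F))) ⟩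
    Z + ∑ (λ F → ∣ F ∣ ! * S g F) ∎
    where
    open ≤-Reasoning
    Z = ∣ ⊥ {n} ∣ ! * g ⊥
    shift : ∀ F → 0 < ∣ F ∣ → ∣ F ∣ ! * g F ≤ ∣ F ∣ * (pred ∣ F ∣ ! * g F)
    shift F _ with ∣ F ∣
    ... | suc k = ≤-reflexive (*-assoc (suc k) (k !) (g F))
    size : ∀ F K → suc (co K) ≡ co F → pred ∣ K ∣ ! * g K ≡ ∣ F ∣ ! * g K
    size F K p = cong (λ k → pred k ! * g K) (+-cancelʳ-≡ (co K) ∣ K ∣ (suc ∣ F ∣) (begin-equality
      ∣ K ∣ + co K       ≡⟨ trans (∣F∣+co K) (sym (∣F∣+co F)) ⟩
      ∣ F ∣ + co F       ≡⟨ cong (∣ F ∣ +_) (sym p) ⟩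
      ∣ F ∣ + suc (co K) ≡⟨ +-suc ∣ F ∣ (co K) ⟩
      suc ∣ F ∣ + co K ∎))

  count : ∀ {n} → Family n → List (Subset n) → ℕ
  count F xs = List.length (List.filter (λ s → F s Bool.≟ true) xs)

  count-∷ : ∀ {n} (F : Family (suc n)) b xs → count F (List.map (b ∷_) xs) ≡ count (F ∘ (b ∷_)) xs
  count-∷ F b List.[]       = refl
  count-∷ F b (x List.∷ xs) with F (b ∷ x)
  ... | true  = cong suc (count-∷ F b xs)
  ... | false = count-∷ F b xs

  card≡∑ : ∀ {n} (F : Family n) → card F ≡ ∑ (λ X → ⟦ F X ⟧)
  card≡∑ {zero} F with F []
  ... | true  = refl
  ... | false = refl
  card≡∑ {suc n} F = begin
    count F (List.map (true ∷_) (allSets n) List.++ List.map (false ∷_) (allSets n))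
      ≡⟨ cong List.length (filter-++ (λ s → F s Bool.≟ true) (List.map (true ∷_) (allSets n)) _) ⟩
    List.length (List.filter _ (List.map (true ∷_) (allSets n)) List.++ List.filter _ (List.map (false ∷_) (allSets n)))
      ≡⟨ length-++ (List.filter _ (List.map (true ∷_) (allSets n))) ⟩
    count F (List.map (true ∷_) (allSets n)) + count F (List.map (false ∷_) (allSets n))
      ≡⟨ cong₂ _+_ (trans (count-∷ F true (allSets n)) (card≡∑ (F ∘ (true ∷_))))
                   (trans (count-∷ F false (allSets n)) (card≡∑ (F ∘ (false ∷_)))) ⟩
    ∑ (λ X → ⟦ F (true ∷ X) ⟧) + ∑ (λ X → ⟦ F (false ∷ X) ⟧) ∎
    where open ≡-Reasoning

  -- Chains and the towers of rich members

  ≤ᵇ-true : ∀ {m n} → (m ≤ᵇ n) ≡ true → m ≤ n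
  ≤ᵇ-true {m} {n} eq = ≤ᵇ⇒≤ m n (subst T (sym eq) tt)

  ≤⇒≤ᵇ-true : ∀ {m n} → m ≤ n → (m ≤ᵇ n) ≡ true
  ≤⇒≤ᵇ-true {m} {n} m≤n with m ≤ᵇ n | ≤⇒≤ᵇ m≤n
  ... | true | _ = refl

  ≤ᵇ-false : ∀ {m n} → (m ≤ᵇ n) ≡ false → n < m
  ≤ᵇ-false {m} {n} eq = ≰⇒> λ m≤n → subst T eq (≤⇒≤ᵇ m≤n)

  ∧-true : ∀ {a b} → a ∧ b ≡ true → a ≡ true × b ≡ true
  ∧-true {true} eq = refl , eq

  central : ℕ → ℕ
  central n = n C ⌊ n /2⌋

  central-! : ∀ n → central n * (⌊ n /2⌋ ! * ⌈ n /2⌉ !) ≡ n !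
  central-! n = begin
    central n * (k ! * ⌈ n /2⌉ !)  ≡⟨ cong (λ z → central n * (k ! * z !)) n∸k ⟨
    central n * (k ! * (n ∸ k) !)  ≡⟨ cong (_* (k ! * (n ∸ k) !)) C≡ ⟩
    _                              ≡⟨ m/n*n≡m {{k !* (n ∸ k) !≢0}} (k![n∸k]!∣n! (⌊n/2⌋≤n n)) ⟩
    n ! ∎
    where
    open ≡-Reasoning
    k = ⌊ n /2⌋
    C≡ = nCk≡n!/k![n-k]! (⌊n/2⌋≤n n)
    n∸k : n ∸ k ≡ ⌈ n /2⌉
    n∸k = trans (cong (_∸ k) (sym (⌊n/2⌋+⌈n/2⌉≡n n))) (m+n∸m≡n k ⌈ n /2⌉)

  !-shift : ∀ {a b} d → a ≤ b → (d + a) ! * b ! ≤ a ! * (d + b) !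
  !-shift         zero    a≤b = ≤-refl
  !-shift {a} {b} (suc d) a≤b = begin
    suc (d + a) * (d + a) ! * b !    ≡⟨ *-assoc (suc (d + a)) ((d + a) !) (b !) ⟩
    suc (d + a) * ((d + a) ! * b !)  ≤⟨ *-mono-≤ (s≤s (+-monoʳ-≤ d a≤b)) (!-shift d a≤b) ⟩
    suc (d + b) * (a ! * (d + b) !)  ≡⟨ swap (suc (d + b)) (a !) _ ⟩
    a ! * (suc (d + b) * (d + b) !) ∎
    where
    open ≤-Reasoning
    swap : ∀ x y z → x * (y * z) ≡ y * (x * z)
    swap = solve-∀

  -- The middle binomial coefficient is the largest, in factorial form. One of the two parts is at
  -- most the lower half, and log-convexity of the factorial (`!-shift`) moves that part to the
  -- middle.
  ⌊/2⌋!⌈/2⌉!≤ : ∀ a b → ⌊ a + b /2⌋ ! * ⌈ a + b /2⌉ ! ≤ a ! * b !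
  ⌊/2⌋!⌈/2⌉!≤ a b = go (≤-total a m)
    where
    open ≤-Reasoning
    m = ⌊ a + b /2⌋
    m′ = ⌈ a + b /2⌉
    m+m′ : m + m′ ≡ a + b
    m+m′ = ⌊n/2⌋+⌈n/2⌉≡n (a + b)
    low : ∀ {a b} → a ≤ m → m + m′ ≡ a + b → m ! * m′ ! ≤ a ! * b !
    low {a} {b} a≤m eq = begin
      m ! * m′ !            ≡⟨ cong (λ z → z ! * m′ !) (m∸n+n≡m a≤m) ⟨
      (d + a) ! * m′ !      ≤⟨ !-shift d (≤-trans a≤m (⌊n/2⌋≤⌈n/2⌉ _)) ⟩
      a ! * (d + m′) !      ≡⟨ cong (λ z → a ! * z !) (+-cancelˡ-≡ a (d + m′) b a+d+m′) ⟩
      a ! * b ! ∎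
      where
      d = m ∸ a
      a+d+m′ : a + (d + m′) ≡ a + b
      a+d+m′ = trans (sym (+-assoc a d m′)) (trans (cong (_+ m′) (m+[n∸m]≡n a≤m)) eq)
    go : a ≤ m ⊎ m ≤ a → m ! * m′ ! ≤ a ! * b !
    go (inj₁ a≤m) = low a≤m m+m′
    go (inj₂ m≤a) with m≤n⇒m<n∨m≡n m≤a
    ... | inj₂ m≡a = low (≤-reflexive (sym m≡a)) m+m′
    ... | inj₁ m<a = ≤-trans (low {b} {a} b≤m (trans m+m′ (+-comm a b))) (≤-reflexive (*-comm (b !) (a !)))
      where
      m′≤a : m′ ≤ a
      m′≤a = ≤-trans (⌈n/2⌉≤1+⌊n/2⌋ (a + b)) m<a
        where
        ⌈n/2⌉≤1+⌊n/2⌋ : ∀ n → ⌈ n /2⌉ ≤ suc ⌊ n /2⌋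
        ⌈n/2⌉≤1+⌊n/2⌋ zero          = z≤n
        ⌈n/2⌉≤1+⌊n/2⌋ (suc zero)    = ≤-refl
        ⌈n/2⌉≤1+⌊n/2⌋ (suc (suc n)) = s≤s (⌈n/2⌉≤1+⌊n/2⌋ n)
      b≤m : b ≤ m
      b≤m = +-cancelˡ-≤ a b m (begin
        a + b   ≡⟨ m+m′ ⟨
        m + m′  ≤⟨ +-monoʳ-≤ m m′≤a ⟩
        m + a   ≡⟨ +-comm m a ⟩
        a + m ∎)

  -- F lies on `∣ F ∣ ! * co F !` of the `n !` maximal chains, a share of at least `1 / central n`.
  -- This is the inequality behind the LYM argument.
  n!≤central : ∀ {n} (F : Subset n) → n ! ≤ central n * (∣ F ∣ ! * co F !)
  n!≤central {n} F = begin
    n !                                     ≡⟨ central-! n ⟨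
    central n * (⌊ n /2⌋ ! * ⌈ n /2⌉ !)     ≤⟨ *-monoʳ-≤ (central n) bound ⟩
    central n * (∣ F ∣ ! * co F !) ∎
    where
    open ≤-Reasoning
    bound : ⌊ n /2⌋ ! * ⌈ n /2⌉ ! ≤ ∣ F ∣ ! * co F !
    bound = subst (λ z → ⌊ z /2⌋ ! * ⌈ z /2⌉ ! ≤ ∣ F ∣ ! * co F !) (∣F∣+co F) (⌊/2⌋!⌈/2⌉!≤ ∣ F ∣ (co F))

  -- u G F is the number of maximal chains from F to the full set that meet G.
  u′ : ∀ {n} → Family n → ℕ → Subset n → ℕ
  u′ G zero    F = if G F then 1 else 0
  u′ G (suc m) F = if G F then suc m ! else S (u′ G m) F

  u : ∀ {n} → Family n → Subset n → ℕ
  u G F = u′ G (co F) F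

  S-zero : ∀ {n} (f : Subset n → ℕ) F → co F ≡ 0 → S f F ≡ 0
  S-zero f F eq = n≤0⇒n≡0 (≤-trans (S-const {c = ∑ f} F (λ K _ → term≤∑ f K)) (≤-reflexive (cong (_* ∑ f) eq)))

  -- `u′` recurses on a separate number to be structural; here that number disappears. At 0 the set
  -- is full and has no upper covers, so the empty sum agrees with the value 0.
  u-unfold : ∀ {n} (G : Family n) F → u G F ≡ (if G F then co F ! else S (u G) F)
  u-unfold G F = go (co F) refl
    where
    go : ∀ m → co F ≡ m → u′ G m F ≡ (if G F then m ! else S (u G) F)
    go zero    eq = cong (if G F then 1 else_) (sym (S-zero (u G) F eq))
    go (suc m) eq = cong (if G F then suc m ! else_) (S-cong F λ K p →
      cong (λ z → u′ G z K) (suc-injective (trans (sym eq) (sym p))))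

  u-member : ∀ {n} (G : Family n) F → G F ≡ true → u G F ≡ co F !
  u-member G F eq = trans (u-unfold G F) (cong (λ b → if b then co F ! else S (u G) F) eq)

  u-nonmember : ∀ {n} (G : Family n) F → G F ≡ false → u G F ≡ S (u G) F
  u-nonmember G F eq = trans (u-unfold G F) (cong (λ b → if b then co F ! else S (u G) F) eq)

  S≤co! : ∀ {n} {f : Subset n → ℕ} F → (∀ K → suc (co K) ≡ co F → f K ≤ co K !) → S f F ≤ co F !
  S≤co! {f = f} F f≤ = go (co F) refl
    where
    go : ∀ m → co F ≡ m → S f F ≤ m !
    go zero    eq = ≤-trans (≤-reflexive (S-zero f F eq)) z≤n
    go (suc m) eq = ≤-trans
      (S-const F λ K p → ≤-trans (f≤ K p) (≤-reflexive (cong _! (suc-injective (trans p eq)))))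
      (≤-reflexive (cong (_* m !) eq))

  co-induction : ∀ {n} (P : Subset n → Set) → (∀ F → (∀ K → suc (co K) ≡ co F → P K) → P F) → ∀ F → P F
  co-induction P step F = go (co F) F refl
    where
    go : ∀ m F → co F ≡ m → P F
    go zero    F eq = step F λ K p → ⊥-elim (1+n≢0 (trans p eq))
    go (suc m) F eq = step F λ K p → go m K (suc-injective (trans p eq))

  u≤co! : ∀ {n} (G : Family n) F → u G F ≤ co F !
  u≤co! G = co-induction (λ F → u G F ≤ co F !) step
    where
    step : ∀ F → (∀ K → suc (co K) ≡ co F → u G K ≤ co K !) → u G F ≤ co F !
    step F ih with G F in eq
    ... | true  = ≤-reflexive (u-member G F eq)
    ... | false = ≤-trans (≤-reflexive (u-nonmember G F eq)) (S≤co! F ih)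

  -- `S (u G) F` counts the chains from F that meet `G` strictly above F, and `u G F` those that
  -- meet it at F or above.
  Su≤u : ∀ {n} (G : Family n) F → S (u G) F ≤ u G F
  Su≤u G F with G F in eq
  ... | true  = ≤-trans (S≤co! F (λ K _ → u≤co! G K)) (≤-reflexive (sym (u-member G F eq)))
  ... | false = ≤-reflexive (sym (u-nonmember G F eq))

  rich poor : ∀ {n} → ℕ → Family n → Family n
  rich b G F = G F ∧ (co F ! ≤ᵇ b * S (u G) F)
  poor b G F = G F ∧ not (co F ! ≤ᵇ b * S (u G) F)

  card-split : ∀ {n} b (G : Family n) → card G ≤ card (poor b G) + card (rich b G)
  card-split b G = begin
    card G                                                   ≡⟨ card≡∑ G ⟩
    ∑ (λ F → ⟦ G F ⟧)                                        ≤⟨ ∑-mono split ⟩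
    ∑ (λ F → ⟦ poor b G F ⟧ + ⟦ rich b G F ⟧)                ≡⟨ ∑-+ (λ F → ⟦ poor b G F ⟧) _ ⟩
    ∑ (λ F → ⟦ poor b G F ⟧) + ∑ (λ F → ⟦ rich b G F ⟧)      ≡⟨ cong₂ _+_ (card≡∑ (poor b G)) (card≡∑ (rich b G)) ⟨
    card (poor b G) + card (rich b G) ∎
    where
    open ≤-Reasoning
    split : ∀ F → ⟦ G F ⟧ ≤ ⟦ poor b G F ⟧ + ⟦ rich b G F ⟧
    split F with G F | co F ! ≤ᵇ b * S (u G) F
    ... | true  | true  = ≤-refl
    ... | true  | false = ≤-refl
    ... | false | _     = z≤n

  -- A random maximal chain meets poor b G at most 1/(1 - 1/b) times on average, so poor b G is almost
  -- as small as an antichain.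
  card-poor : ∀ {n} B (G : Family n) → B * card (poor (suc B) G) ≤ suc B * central n
  card-poor {n} B G = *-cancelʳ-≤ _ _ (n !) {{n !≢0}} (begin
    B * card D * n !                                          ≡⟨ cong (λ z → B * z * n !) (card≡∑ D) ⟩
    B * ∑ (λ F → ⟦ D F ⟧) * n !                               ≡⟨ pull B (∑ (λ F → ⟦ D F ⟧)) (n !) ⟩
    n ! * B * ∑ (λ F → ⟦ D F ⟧)                               ≡⟨ ∑-* (n ! * B) (λ F → ⟦ D F ⟧) ⟨
    ∑ (λ F → n ! * B * ⟦ D F ⟧)                               ≤⟨ ∑-mono (λ F → *-monoˡ-≤ ⟦ D F ⟧ (*-monoˡ-≤ B (n!≤central F))) ⟩
    ∑ (λ F → N * (∣ F ∣ ! * co F !) * B * ⟦ D F ⟧)            ≡⟨ ∑-cong (λ F → regroup N (∣ F ∣ !) (co F !) B ⟦ D F ⟧) ⟩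
    ∑ (λ F → N * (∣ F ∣ ! * (⟦ D F ⟧ * (B * co F !))))        ≡⟨ ∑-* N (λ F → ∣ F ∣ ! * (⟦ D F ⟧ * (B * co F !))) ⟩
    N * ∑ (λ F → ∣ F ∣ ! * (⟦ D F ⟧ * (B * co F !)))          ≤⟨ *-monoʳ-≤ N lubell ⟩
    N * (b * n !)                                             ≡⟨ swap N b (n !) ⟩
    b * N * n ! ∎)
    where
    open ≤-Reasoning
    b = suc B
    D = poor b G
    N = central n
    pull : ∀ x y z → x * y * z ≡ z * x * y
    pull = solve-∀
    swap : ∀ x y z → x * (y * z) ≡ y * x * z
    swap = solve-∀
    regroup : ∀ x y z v w → x * (y * z) * v * w ≡ x * (y * (w * (v * z)))
    regroup = solve-∀
    -- A poor F has `u G F = co F !` but `b * S (u G) F < co F !`, so the drop from `b * u G F` to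
    -- `b * S (u G) F` is at least `B * co F !`. Elsewhere the drop is just nonnegative.
    pointwise : ∀ F → ⟦ D F ⟧ * (B * co F !) + b * S (u G) F ≤ b * u G F
    pointwise F with G F in member
    ... | false = *-monoʳ-≤ b (Su≤u G F)
    ... | true with co F ! ≤ᵇ b * S (u G) F in cmp
    ...   | true  = *-monoʳ-≤ b (Su≤u G F)
    ...   | false = begin
      1 * (B * co F !) + b * S (u G) F ≤⟨ +-mono-≤ (≤-reflexive (*-identityˡ (B * co F !))) (<⇒≤ (≤ᵇ-false {co F !} cmp)) ⟩
      B * co F ! + co F !              ≡⟨ +-comm (B * co F !) (co F !) ⟩
      b * co F !                       ≡⟨ cong (b *_) (u-member G F member) ⟨
      b * u G F ∎
    D-mass Su-mass : Subset n → ℕ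
    D-mass F = ∣ F ∣ ! * (⟦ D F ⟧ * (B * co F !))
    Su-mass F = ∣ F ∣ ! * S (u G) F
    -- Weighted by `∣ F ∣ !`, the drops telescope: by `∑-weighted` the sums of `u G` and of
    -- `S (u G)` differ by at most the contribution of the empty set, which is at most `n !`.
    lubell : ∑ D-mass ≤ b * n !
    lubell = +-cancelʳ-≤ (b * ∑ Su-mass) _ _ (begin
      ∑ D-mass + b * ∑ Su-mass                        ≡⟨ cong (∑ D-mass +_) (∑-* b Su-mass) ⟨
      ∑ D-mass + ∑ (λ F → b * Su-mass F)              ≡⟨ ∑-+ D-mass (λ F → b * Su-mass F) ⟨
      ∑ (λ F → D-mass F + b * Su-mass F)              ≤⟨ ∑-mono (λ F → weigh (∣ F ∣ !) (⟦ D F ⟧ * (B * co F !)) (S (u G) F) (u G F) (pointwise F)) ⟩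
      ∑ (λ F → b * (∣ F ∣ ! * u G F))                 ≡⟨ ∑-* b (λ F → ∣ F ∣ ! * u G F) ⟩
      b * ∑ (λ F → ∣ F ∣ ! * u G F)                   ≤⟨ *-monoʳ-≤ b (∑-weighted (u G)) ⟩
      b * (∣ ⊥ {n} ∣ ! * u G ⊥ + ∑ Su-mass)           ≤⟨ *-monoʳ-≤ b (+-monoˡ-≤ (∑ Su-mass) bottom) ⟩
      b * (n ! + ∑ Su-mass)                           ≡⟨ *-distribˡ-+ b (n !) _ ⟩
      b * n ! + b * ∑ Su-mass ∎)
      where
      weigh : ∀ w x y z → x + b * y ≤ b * z → w * x + b * (w * y) ≤ b * (w * z)
      weigh w x y z le = begin
        w * x + b * (w * y) ≡⟨ (solve w x y b) ⟩
        w * (x + b * y)     ≤⟨ *-monoʳ-≤ w le ⟩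
        w * (b * z)         ≡⟨ comm w b z ⟩
        b * (w * z) ∎
        where
        solve : ∀ w x y b → w * x + b * (w * y) ≡ w * (x + b * y)
        solve = solve-∀
        comm : ∀ w b z → w * (b * z) ≡ b * (w * z)
        comm = solve-∀
      bottom : ∣ ⊥ {n} ∣ ! * u G ⊥ ≤ n !
      bottom = begin
        ∣ ⊥ {n} ∣ ! * u G ⊥   ≡⟨ cong (λ z → z ! * u G ⊥) (∣⊥∣≡0 n) ⟩
        1 * u G ⊥             ≡⟨ *-identityˡ (u G ⊥) ⟩
        u G ⊥                 ≤⟨ u≤co! G ⊥ ⟩
        co (⊥ {n}) !          ≡⟨ cong _! (trans (cong (_+ co (⊥ {n})) (sym (∣⊥∣≡0 n))) (∣F∣+co (⊥ {n}))) ⟩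
        n ! ∎

  tower : ∀ {n} → ℕ → Family n → ℕ → Family n
  tower b F zero    = F
  tower b F (suc j) = rich b (tower b F j)

  -- A round removes only poor members, and by `card-poor` these amount to at most `suc B / B`
  -- middle levels.
  card-tower : ∀ {n} B (F : Family n) j →
               B * card F ≤ j * (suc B * central n) + B * card (tower (suc B) F j)
  card-tower {n} B F zero    = ≤-refl
  card-tower {n} B F (suc j) = begin
    B * card F                                        ≤⟨ card-tower B F j ⟩
    j * M + B * card G                                ≤⟨ +-monoʳ-≤ (j * M) (*-monoʳ-≤ B (card-split (suc B) G)) ⟩
    j * M + B * (card (poor (suc B) G) + card (rich (suc B) G))
      ≡⟨ cong (j * M +_) (*-distribˡ-+ B (card (poor (suc B) G)) _) ⟩
    j * M + (B * card (poor (suc B) G) + R)           ≤⟨ +-monoʳ-≤ (j * M) (+-monoˡ-≤ R (card-poor B G)) ⟩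
    j * M + (M + R)                                   ≡⟨ rearrange (j * M) M R ⟩
    suc j * M + R ∎
    where
    open ≤-Reasoning
    M = suc B * central n
    G = tower (suc B) F j
    R = B * card (rich (suc B) G)
    rearrange : ∀ x y z → x + (y + z) ≡ y + x + z
    rearrange = solve-∀

  tower-anti : ∀ {n} b (F : Family n) {i j} → i ≤ j → ∀ X → tower b F j X ≡ true → tower b F i X ≡ true
  tower-anti b F {i} i≤j X = go (≤⇒≤′ i≤j)
    where
    go : ∀ {j} → i ≤′ j → tower b F j X ≡ true → tower b F i X ≡ true
    go ≤′-refl       eq = eq
    go (≤′-step i≤j) eq = go i≤j (proj₁ (∧-true eq))

  -- Sums `f` over the ends of all upward walks of `g` steps. Applied to `u G` it counts the maximal
  -- chains that meet `G` at least `g` levels up.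
  S^ : ∀ {n} → ℕ → (Subset n → ℕ) → Subset n → ℕ
  S^ zero    f = f
  S^ (suc g) f = S (S^ g f)

  S^-mono : ∀ {n} g {f f′ : Subset n → ℕ} → (∀ F → f F ≤ f′ F) → ∀ F → S^ g f F ≤ S^ g f′ F
  S^-mono zero    f≤ F = f≤ F
  S^-mono (suc g) f≤ F = S-mono F λ K _ → S^-mono g f≤ K

  S^-shift : ∀ {n} g (f : Subset n → ℕ) F → S^ g (S f) F ≡ S (S^ g f) F
  S^-shift zero    f F = refl
  S^-shift (suc g) f F = S-cong F λ K _ → S^-shift g f K

  -- Conditioning on the first encounter: at least one chain in `b` from X meets the previous tower
  -- strictly above X, and from the first member met there, by induction, a share of at least
  -- `1 / b ^ g` goes on to meet `tower b F j` at least `g` levels higher.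
  tower-rich : ∀ {n} b (F : Family n) g j X → tower b F (g + j) X ≡ true →
               co X ! ≤ b ^ g * S^ g (u (tower b F j)) X
  tower-rich b F zero    j X eq = ≤-reflexive (trans (sym (u-member (tower b F j) X eq)) (sym (*-identityˡ _)))
  tower-rich {n} b F (suc g) j X eq = begin
    co X !                                     ≤⟨ ≤ᵇ-true {co X !} (proj₂ (∧-true {tower b F (g + j) X} eq)) ⟩
    b * S (u G) X                              ≤⟨ *-monoʳ-≤ b (S-mono X λ K _ → u≤ K) ⟩
    b * S (λ K → b ^ g * S^ g (u H) K) X       ≡⟨ cong (b *_) (S-* (b ^ g) (S^ g (u H)) X) ⟩
    b * (b ^ g * S^ (suc g) (u H) X)           ≡⟨ *-assoc b (b ^ g) _ ⟨
    b ^ suc g * S^ (suc g) (u H) X ∎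
    where
    open ≤-Reasoning
    G = tower b F (g + j)
    H = tower b F j
    -- Outside `G` the chain walks on by one more step. This only increases the distance, and `Su≤u`
    -- gives the surplus step away.
    step : ∀ K → (∀ L → suc (co L) ≡ co K → u G L ≤ b ^ g * S^ g (u H) L) → u G K ≤ b ^ g * S^ g (u H) K
    step K ih with G K in member
    ... | true  = ≤-trans (u≤co! G K) (tower-rich b F g j K member)
    ... | false = begin
      u G K                               ≡⟨ u-nonmember G K member ⟩
      S (u G) K                           ≤⟨ S-mono K ih ⟩
      S (λ L → b ^ g * S^ g (u H) L) K    ≡⟨ S-* (b ^ g) (S^ g (u H)) K ⟩
      b ^ g * S (S^ g (u H)) K            ≡⟨ cong (b ^ g *_) (S^-shift g (u H) K) ⟨
      b ^ g * S^ g (S (u H)) K            ≤⟨ *-monoʳ-≤ (b ^ g) (S^-mono g (Su≤u H) K) ⟩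
      b ^ g * S^ g (u H) K ∎
    u≤ : ∀ K → u G K ≤ b ^ g * S^ g (u H) K
    u≤ = co-induction _ step

  -- Counting members above a set

  infix 4 _⊑_

  _⊑_ : ∀ {n} → Subset n → Subset n → Bool
  []          ⊑ []          = true
  (true ∷ F)  ⊑ (true ∷ H)  = F ⊑ H
  (true ∷ F)  ⊑ (false ∷ H) = false
  (false ∷ F) ⊑ (_ ∷ H)     = F ⊑ H

  gap : ∀ {n} → Subset n → Subset n → ℕ
  gap []          []          = 0
  gap (true ∷ F)  (_ ∷ H)     = gap F H
  gap (false ∷ F) (true ∷ H)  = suc (gap F H)
  gap (false ∷ F) (false ∷ H) = gap F H

  ⊑-refl : ∀ {n} (F : Subset n) → (F ⊑ F) ≡ true
  ⊑-refl []          = refl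
  ⊑-refl (true ∷ F)  = ⊑-refl F
  ⊑-refl (false ∷ F) = ⊑-refl F

  gap-self : ∀ {n} (F : Subset n) → gap F F ≡ 0
  gap-self []          = refl
  gap-self (true ∷ F)  = gap-self F
  gap-self (false ∷ F) = gap-self F

  gap+co : ∀ {n} (F H : Subset n) → (F ⊑ H) ≡ true → gap F H + co H ≡ co F
  gap+co []          []          F⊑H = refl
  gap+co (true ∷ F)  (true ∷ H)  F⊑H = gap+co F H F⊑H
  gap+co (false ∷ F) (true ∷ H)  F⊑H = cong suc (gap+co F H F⊑H)
  gap+co (false ∷ F) (false ∷ H) F⊑H = trans (+-suc (gap F H) (co H)) (cong suc (gap+co F H F⊑H))

  -- If F lies below H, exactly `gap F H` upper covers of F do so too, each with its gap smaller by
  -- one. For gap 0 the factor `gap F H` cancels the meaningless `pred 0`.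
  S-⊑ : ∀ {n} (ψ : ℕ → ℕ) (F H : Subset n) →
        S (λ K → ⟦ K ⊑ H ⟧ * ψ (gap K H)) F ≡ ⟦ F ⊑ H ⟧ * (gap F H * ψ (pred (gap F H)))
  S-⊑ ψ []          []          = refl
  S-⊑ ψ (true ∷ F)  (true ∷ H)  = S-⊑ ψ F H
  S-⊑ ψ (true ∷ F)  (false ∷ H) = S-* 0 (λ _ → 0) F
  S-⊑ ψ (false ∷ F) (false ∷ H) = S-⊑ ψ F H
  S-⊑ ψ (false ∷ F) (true ∷ H)  = trans (cong (⟦ F ⊑ H ⟧ * ψ (gap F H) +_) (S-⊑ (ψ ∘ suc) F H))
                                        (merge ⟦ F ⊑ H ⟧ (gap F H))
    where
    merge : ∀ a d → a * ψ d + a * (d * ψ (suc (pred d))) ≡ a * (suc d * ψ d)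
    merge a zero    = trans (cong (a * ψ 0 +_) (*-zeroʳ a))
                            (trans (+-identityʳ _) (cong (a *_) (sym (*-identityˡ (ψ 0)))))
    merge a (suc d) = sym (*-distribˡ-+ a (ψ (suc d)) _)

  -- The number of orderings of a d-element set if g ≤ d, and 0 otherwise.
  orderings : ℕ → ℕ → ℕ
  orderings zero    d       = d !
  orderings (suc g) zero    = 0
  orderings (suc g) (suc d) = suc d * orderings g d

  orderings-suc : ∀ g d → d * orderings g (pred d) ≡ orderings (suc g) d
  orderings-suc g zero    = refl
  orderings-suc g (suc d) = refl

  orderings-cases : ∀ g d → orderings g d ≡ 0 ⊎ (g ≤ d × orderings g d ≡ d !)
  orderings-cases zero    d       = inj₂ (z≤n , refl)
  orderings-cases (suc g) zero    = inj₁ refl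
  orderings-cases (suc g) (suc d) with orderings-cases g d
  ... | inj₁ eq         = inj₁ (trans (cong (suc d *_) eq) (*-zeroʳ (suc d)))
  ... | inj₂ (g≤d , eq) = inj₂ (s≤s g≤d , cong (suc d *_) eq)

  ^-!≤ : ∀ {r c} g → r ≤ c → r ^ g * c ! ≤ (g + c) !
  ^-!≤ {r} {c} zero    r≤c = ≤-reflexive (*-identityˡ (c !))
  ^-!≤ {r} {c} (suc g) r≤c = begin
    r * r ^ g * c !        ≡⟨ *-assoc r (r ^ g) (c !) ⟩
    r * (r ^ g * c !)      ≤⟨ *-mono-≤ (≤-trans r≤c (m≤n+m c (suc g))) (^-!≤ g r≤c) ⟩
    suc (g + c) * (g + c) ! ∎
    where open ≤-Reasoning

  -- The binomial coefficient of `d + c` over `d` is at least `r ^ g / g !`: it grows with `d`, and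
  -- `^-!≤` is the case `d = g`. Members further up than required thus take no larger share of the
  -- chains.
  !-^-!≤ : ∀ {r c g d} → r ≤ c → g ≤ d → d ! * (r ^ g * c !) ≤ (d + c) ! * g !
  !-^-!≤ {r} {c} {g} r≤c g≤d = go (≤⇒≤′ g≤d)
    where
    open ≤-Reasoning
    go : ∀ {d} → g ≤′ d → d ! * (r ^ g * c !) ≤ (d + c) ! * g !
    go ≤′-refl = ≤-trans (*-monoʳ-≤ (g !) (^-!≤ g r≤c)) (≤-reflexive (*-comm (g !) _))
    go {suc d} (≤′-step g≤d) = begin
      suc d * d ! * (r ^ g * c !)         ≡⟨ *-assoc (suc d) (d !) _ ⟩
      suc d * (d ! * (r ^ g * c !))       ≤⟨ *-mono-≤ (m≤m+n (suc d) c) (go g≤d) ⟩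
      suc (d + c) * ((d + c) ! * g !)     ≡⟨ *-assoc (suc (d + c)) ((d + c) !) (g !) ⟨
      suc (d + c) * (d + c) ! * g ! ∎

  orderings-bound : ∀ {r c} g d → r ≤ c → orderings g d * (r ^ g * c !) ≤ (d + c) ! * g !
  orderings-bound g d r≤c with orderings-cases g d
  ... | inj₁ eq         rewrite eq = z≤n
  ... | inj₂ (g≤d , eq) rewrite eq = !-^-!≤ r≤c g≤d

  -- through g G F is the sum, over the members of G that lie at least g levels above F, of the number of
  -- maximal chains from F to the full set through that member.
  through : ∀ {n} → ℕ → Family n → Subset n → ℕ
  through g G F = ∑ λ H → ⟦ G H ⟧ * co H ! * (⟦ F ⊑ H ⟧ * orderings g (gap F H))

  S-through : ∀ {n} g (G : Family n) F → S (through g G) F ≡ through (suc g) G F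
  S-through g G F = trans (S-∑ (λ H K → ⟦ G H ⟧ * co H ! * (⟦ K ⊑ H ⟧ * orderings g (gap K H))) F) (∑-cong λ H → begin
    S (λ K → ⟦ G H ⟧ * co H ! * (⟦ K ⊑ H ⟧ * orderings g (gap K H))) F
      ≡⟨ S-* (⟦ G H ⟧ * co H !) (λ K → ⟦ K ⊑ H ⟧ * orderings g (gap K H)) F ⟩
    ⟦ G H ⟧ * co H ! * S (λ K → ⟦ K ⊑ H ⟧ * orderings g (gap K H)) F
      ≡⟨ cong (⟦ G H ⟧ * co H ! *_) (S-⊑ (orderings g) F H) ⟩
    ⟦ G H ⟧ * co H ! * (⟦ F ⊑ H ⟧ * (gap F H * orderings g (pred (gap F H))))
      ≡⟨ cong (λ z → ⟦ G H ⟧ * co H ! * (⟦ F ⊑ H ⟧ * z)) (orderings-suc g (gap F H)) ⟩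
    ⟦ G H ⟧ * co H ! * (⟦ F ⊑ H ⟧ * orderings (suc g) (gap F H)) ∎)
    where open ≡-Reasoning

  -- Union bound: a chain that meets `G` is counted once for each member on it, hence at least once.
  u≤through : ∀ {n} (G : Family n) F → u G F ≤ through 0 G F
  u≤through G = co-induction _ step
    where
    open ≤-Reasoning
    step : ∀ F → (∀ K → suc (co K) ≡ co F → u G K ≤ through 0 G K) → u G F ≤ through 0 G F
    step F ih with G F in member
    ... | true  = begin
      u G F                                                        ≡⟨ u-member G F member ⟩
      co F !                                                       ≡⟨ one (co F !) ⟩
      1 * co F ! * (1 * 1)
        ≡⟨ cong₂ _*_ (cong (λ z → ⟦ z ⟧ * co F !) member) (cong₂ (λ y z → ⟦ y ⟧ * z !) (⊑-refl F) (gap-self F)) ⟨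
      ⟦ G F ⟧ * co F ! * (⟦ F ⊑ F ⟧ * gap F F !)                   ≤⟨ term≤∑ (λ H → ⟦ G H ⟧ * co H ! * (⟦ F ⊑ H ⟧ * gap F H !)) F ⟩
      through 0 G F ∎
      where
      one : ∀ x → x ≡ 1 * x * (1 * 1)
      one = solve-∀
    ... | false = begin
      u G F          ≡⟨ u-nonmember G F member ⟩
      S (u G) F      ≤⟨ S-mono F ih ⟩
      S (through 0 G) F    ≡⟨ S-through 0 G F ⟩
      through 1 G F        ≤⟨ ∑-mono (λ H → *-monoʳ-≤ (⟦ G H ⟧ * co H !) (*-monoʳ-≤ ⟦ F ⊑ H ⟧ (drop (gap F H)))) ⟩
      through 0 G F ∎
      where
      drop : ∀ d → orderings 1 d ≤ orderings 0 d
      drop zero    = z≤n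
      drop (suc d) = ≤-refl

  S^u≤through : ∀ {n} g (G : Family n) F → S^ g (u G) F ≤ through g G F
  S^u≤through zero    G F = u≤through G F
  S^u≤through (suc g) G F = ≤-trans (S-mono F λ K _ → S^u≤through g G K) (≤-reflexive (S-through g G F))

  above : ∀ {n} → Family n → Subset n → ℕ
  above G F = ∑ λ H → ⟦ G H ⟧ * ⟦ F ⊑ H ⟧

  -- Of the `co F !` chains from F, a member H with gap d ≥ g lies on `d ! * co H !`, and
  -- `orderings-bound` limits this to a share `g ! / r ^ g`. So many chains need many members.
  through≤above : ∀ {n r} g (G : Family n) F → (∀ H → G H ≡ true → r ≤ co H) →
            through g G F * r ^ g ≤ above G F * (co F ! * g !)
  through≤above {n} {r} g G F r≤co = begin
    through g G F * r ^ g                                   ≡⟨ *-comm (through g G F) (r ^ g) ⟩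
    r ^ g * through g G F                                   ≡⟨ ∑-* (r ^ g) (λ H → ⟦ G H ⟧ * co H ! * (⟦ F ⊑ H ⟧ * orderings g (gap F H))) ⟨
    ∑ (λ H → r ^ g * (⟦ G H ⟧ * co H ! * (⟦ F ⊑ H ⟧ * orderings g (gap F H)))) ≤⟨ ∑-mono pointwise ⟩
    ∑ (λ H → co F ! * g ! * (⟦ G H ⟧ * ⟦ F ⊑ H ⟧))    ≡⟨ ∑-* (co F ! * g !) (λ H → ⟦ G H ⟧ * ⟦ F ⊑ H ⟧) ⟩
    co F ! * g ! * above G F                          ≡⟨ *-comm (co F ! * g !) (above G F) ⟩
    above G F * (co F ! * g !) ∎
    where
    open ≤-Reasoning
    pointwise : ∀ H → r ^ g * (⟦ G H ⟧ * co H ! * (⟦ F ⊑ H ⟧ * orderings g (gap F H))) ≤ co F ! * g ! * (⟦ G H ⟧ * ⟦ F ⊑ H ⟧)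
    pointwise H with G H in member | F ⊑ H in F⊑H
    ... | false | _     = ≤-trans (≤-reflexive (*-zeroʳ (r ^ g))) z≤n
    ... | true  | false = ≤-trans (≤-reflexive (zero³ (r ^ g) (co H !))) z≤n
      where
      zero³ : ∀ x y → x * (1 * y * 0) ≡ 0
      zero³ = solve-∀
    ... | true  | true  = begin
      r ^ g * (1 * co H ! * (1 * orderings g (gap F H)))   ≡⟨ regroup (r ^ g) (co H !) (orderings g (gap F H)) ⟩
      orderings g (gap F H) * (r ^ g * co H !)             ≤⟨ orderings-bound g (gap F H) (r≤co H member) ⟩
      (gap F H + co H) ! * g !                             ≡⟨ cong (λ z → z ! * g !) (gap+co F H F⊑H) ⟩
      co F ! * g !                                         ≡⟨ *-identityʳ (co F ! * g !) ⟨
      co F ! * g ! * 1 ∎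
      where
      regroup : ∀ x y z → x * (1 * y * (1 * z)) ≡ z * (x * y)
      regroup = solve-∀

  tower-above : ∀ {n r} b (F : Family n) g j X → (∀ H → F H ≡ true → r ≤ co H) →
                tower b F (g + j) X ≡ true → r ^ g ≤ b ^ g * g ! * above (tower b F j) X
  tower-above {n} {r} b F g j X r≤co X∈ = *-cancelʳ-≤ _ _ (co X !) {{co X !≢0}} (begin
    r ^ g * co X !                               ≤⟨ *-monoʳ-≤ (r ^ g) (tower-rich b F g j X X∈) ⟩
    r ^ g * (b ^ g * S^ g (u G) X)               ≤⟨ *-monoʳ-≤ (r ^ g) (*-monoʳ-≤ (b ^ g) (S^u≤through g G X)) ⟩
    r ^ g * (b ^ g * through g G X)                    ≡⟨ pull (r ^ g) (b ^ g) (through g G X) ⟩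
    b ^ g * (through g G X * r ^ g)                    ≤⟨ *-monoʳ-≤ (b ^ g) (through≤above g G X λ H H∈ → r≤co H (tower-anti b F {0} {j} z≤n H H∈)) ⟩
    b ^ g * (above G X * (co X ! * g !))         ≡⟨ regroup (b ^ g) (above G X) (co X !) (g !) ⟩
    b ^ g * g ! * above G X * co X ! ∎)
    where
    open ≤-Reasoning
    G = tower b F j
    pull : ∀ x y z → x * (y * z) ≡ y * (z * x)
    pull = solve-∀
    regroup : ∀ x y z w → x * (y * (z * w)) ≡ x * w * y * z
    regroup = solve-∀

  -- Sets near the top of the cube are negligible

  ∑-7^ : ∀ n → ∑ {n} (λ F → 7 ^ ∣ F ∣) ≡ 8 ^ n
  ∑-7^ zero    = refl
  ∑-7^ (suc n) = begin
    ∑ {n} (λ F → 7 * 7 ^ ∣ F ∣) + E   ≡⟨ cong (_+ E) (∑-* {n} 7 (λ F → 7 ^ ∣ F ∣)) ⟩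
    7 * E + E                                        ≡⟨ eight E ⟩
    8 * E                                            ≡⟨ cong (8 *_) (∑-7^ n) ⟩
    8 * 8 ^ n ∎
    where
    open ≡-Reasoning
    E = ∑ {n} (λ F → 7 ^ ∣ F ∣)
    eight : ∀ x → 7 * x + x ≡ 8 * x
    eight = solve-∀

  high : ∀ {n} → ℕ → Family n
  high r X = not (r ≤ᵇ co X)

  -- Exponential Markov inequality with weight `7 ^ ∣ X ∣`: the total weight is `8 ^ n` by the
  -- binomial theorem, and a set with fewer than `r` missing elements weighs at least 7 to the power
  -- n - r.
  card-high : ∀ n r → 7 ^ n * card (high {n} r) ≤ 7 ^ r * 8 ^ n
  card-high n r = begin
    7 ^ n * card (high {n} r)                  ≡⟨ cong (7 ^ n *_) (card≡∑ (high {n} r)) ⟩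
    7 ^ n * ∑ (λ X → ⟦ high {n} r X ⟧)         ≡⟨ ∑-* (7 ^ n) (λ X → ⟦ high {n} r X ⟧) ⟨
    ∑ (λ X → 7 ^ n * ⟦ high {n} r X ⟧)         ≤⟨ ∑-mono pointwise ⟩
    ∑ {n} (λ X → 7 ^ r * 7 ^ ∣ X ∣)            ≡⟨ ∑-* {n} (7 ^ r) (λ X → 7 ^ ∣ X ∣) ⟩
    7 ^ r * ∑ {n} (λ X → 7 ^ ∣ X ∣)            ≡⟨ cong (7 ^ r *_) (∑-7^ n) ⟩
    7 ^ r * 8 ^ n ∎
    where
    open ≤-Reasoning
    pointwise : ∀ X → 7 ^ n * ⟦ high {n} r X ⟧ ≤ 7 ^ r * 7 ^ ∣ X ∣
    pointwise X with r ≤ᵇ co X in cmp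
    ... | true  = ≤-trans (≤-reflexive (*-zeroʳ (7 ^ n))) z≤n
    ... | false = begin
      7 ^ n * 1             ≡⟨ *-identityʳ (7 ^ n) ⟩
      7 ^ n                 ≡⟨ cong (7 ^_) (∣F∣+co X) ⟨
      7 ^ (∣ X ∣ + co X)    ≤⟨ ^-monoʳ-≤ 7 (+-monoʳ-≤ ∣ X ∣ (<⇒≤ (≤ᵇ-false cmp))) ⟩
      7 ^ (∣ X ∣ + r)       ≡⟨ ^-distribˡ-+-* 7 ∣ X ∣ r ⟩
      7 ^ ∣ X ∣ * 7 ^ r     ≡⟨ *-comm (7 ^ ∣ X ∣) (7 ^ r) ⟩
      7 ^ r * 7 ^ ∣ X ∣ ∎

  nCk≤[n+1]Ck : ∀ n k → n C k ≤ suc n C k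
  nCk≤[n+1]Ck n zero    = ≤-refl
  nCk≤[n+1]Ck n (suc k) = ≤-trans (m≤n+m (n C suc k) (n C k)) (≤-reflexive (nCk+nC[k+1]≡[n+1]C[k+1] n k))

  central-≥ : ∀ n → 2 ^ ⌊ n /2⌋ ≤ central n
  central-≥ zero          = ≤-refl
  central-≥ (suc zero)    = ≤-refl
  central-≥ (suc (suc n)) = begin
    2 * 2 ^ k                              ≤⟨ *-monoʳ-≤ 2 (central-≥ n) ⟩
    2 * central n                          ≡⟨ cong (central n +_) (+-identityʳ (central n)) ⟩
    n C k + n C k                          ≤⟨ +-mono-≤ (nCk≤[n+1]Ck n k) (≤-trans (m≤m+n (n C k) (n C suc k)) (≤-reflexive (nCk+nC[k+1]≡[n+1]C[k+1] n k))) ⟩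
    suc n C k + suc n C suc k              ≡⟨ nCk+nC[k+1]≡[n+1]C[k+1] (suc n) k ⟩
    suc (suc n) C suc k ∎
    where
    open ≤-Reasoning
    k = ⌊ n /2⌋

  n≤2^n : ∀ n → n ≤ 2 ^ n
  n≤2^n zero    = z≤n
  n≤2^n (suc n) = begin
    suc n             ≤⟨ +-mono-≤ (m^n>0 2 n) (n≤2^n n) ⟩
    2 ^ n + 2 ^ n     ≡⟨ cong (2 ^ n +_) (+-identityʳ (2 ^ n)) ⟨
    2 * 2 ^ n ∎
    where open ≤-Reasoning

  ⌊n*16/2⌋ : ∀ r q → r * 8 ≤ ⌊ q + r * 16 /2⌋
  ⌊n*16/2⌋ zero    q = z≤n
  ⌊n*16/2⌋ (suc r) q = ≤-trans (+-monoʳ-≤ 8 (⌊n*16/2⌋ r q)) (≤-reflexive (cong ⌊_/2⌋ (shift q (r * 16))))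
    where
    shift : ∀ q x → 16 + (q + x) ≡ q + (16 + x)
    shift = solve-∀

  ^-distribʳ-* : ∀ o x y → (x * y) ^ o ≡ x ^ o * y ^ o
  ^-distribʳ-* zero    x y = refl
  ^-distribʳ-* (suc o) x y = trans (cong (x * y *_) (^-distribʳ-* o x y)) (regroup x y (x ^ o) (y ^ o))
    where
    regroup : ∀ a b c d → a * b * (c * d) ≡ a * c * (b * d)
    regroup = solve-∀

  -- What makes the weight 7 and the cut-off n/16 work: for n = 16 r, `card-high` leaves at most
  -- `(8 ^ 16 / 7 ^ 15) ^ r`, hence at most `2 ^ (7 * r)`, high sets, against a middle level of at
  -- least `2 ^ (8 * r)`.
  8^16≤ : 8 ^ 16 ≤ 7 ^ 15 * 2 ^ 7
  8^16≤ = toWitness {a? = (8 ^ 16) ≤? (7 ^ 15 * 2 ^ 7)} _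

  high-negligible : ∀ K → ∃ λ n₀ → ∀ n → n₀ ≤ n → K * card (high {n} (n / 16)) ≤ central n
  -- The gain is a factor `2 ^ r` with `r = n / 16`; this threshold makes it exceed `K * 2 ^ 16`,
  -- where `2 ^ 16` pays for the remainder of n modulo 16.
  high-negligible K = K * 2 ^ 16 * 16 , bound
    where
    open ≤-Reasoning
    bound : ∀ n → K * 2 ^ 16 * 16 ≤ n → K * card (high {n} (n / 16)) ≤ central n
    bound n n₀≤n = *-cancelʳ-≤ _ _ (2 ^ 16) (begin
      K * t * 2 ^ 16                 ≡⟨ swap K t (2 ^ 16) ⟩
      t * (K * 2 ^ 16)               ≤⟨ *-monoʳ-≤ t (≤-trans K≤r (n≤2^n r)) ⟩
      t * 2 ^ r                      ≤⟨ *-monoˡ-≤ (2 ^ r) t≤ ⟩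
      2 ^ q * (2 ^ 7) ^ r * 2 ^ r    ≡⟨ cong (λ z → 2 ^ q * z * 2 ^ r) (^-*-assoc 2 7 r) ⟩
      2 ^ q * 2 ^ (7 * r) * 2 ^ r    ≡⟨ *-assoc (2 ^ q) (2 ^ (7 * r)) (2 ^ r) ⟩
      2 ^ q * (2 ^ (7 * r) * 2 ^ r)  ≡⟨ cong (2 ^ q *_) (^-distribˡ-+-* 2 (7 * r) r) ⟨
      2 ^ q * 2 ^ (7 * r + r)        ≡⟨ cong (λ z → 2 ^ q * 2 ^ z) (eight r) ⟩
      2 ^ q * 2 ^ (r * 8)            ≤⟨ *-mono-≤ (^-monoʳ-≤ 2 (<⇒≤ (m%n<n n 16))) (^-monoʳ-≤ 2 (⌊n*16/2⌋ r q)) ⟩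
      2 ^ 16 * 2 ^ ⌊ q + r * 16 /2⌋  ≡⟨ cong (λ z → 2 ^ 16 * 2 ^ ⌊ z /2⌋) (sym n≡) ⟩
      2 ^ 16 * 2 ^ ⌊ n /2⌋           ≤⟨ *-monoʳ-≤ (2 ^ 16) (central-≥ n) ⟩
      2 ^ 16 * central n             ≡⟨ *-comm (2 ^ 16) (central n) ⟩
      central n * 2 ^ 16 ∎)
      where
      r = n / 16
      q = n % 16
      t = card (high {n} r)
      n≡ : n ≡ q + r * 16
      n≡ = m≡m%n+[m/n]*n n 16
      K≤r : K * 2 ^ 16 ≤ r
      K≤r = ≤-trans (≤-reflexive (sym (m*n/n≡m (K * 2 ^ 16) 16))) (/-monoˡ-≤ 16 n₀≤n)
      swap : ∀ x y z → x * y * z ≡ y * (x * z)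
      swap = solve-∀
      eight : ∀ x → 7 * x + x ≡ x * 8
      eight = solve-∀
      shuffle : ∀ x y z w v → x * (y * z * (w * v)) ≡ y * (x * w) * (z * v)
      shuffle = solve-∀
      pow : ∀ x r → x ^ r * (x ^ 15) ^ r ≡ x ^ (r * 16)
      pow x r = trans (cong (x ^ r *_) (^-*-assoc x 15 r))
                (trans (sym (^-distribˡ-+-* x r (15 * r))) (cong (x ^_) (sixteen r)))
        where
        sixteen : ∀ r → r + 15 * r ≡ r * 16
        sixteen = solve-∀
      8^n≤ : 8 ^ n ≤ 7 ^ q * 2 ^ q * ((7 ^ 15) ^ r * (2 ^ 7) ^ r)
      8^n≤ = begin
        8 ^ n                                          ≡⟨ cong (8 ^_) n≡ ⟩
        8 ^ (q + r * 16)                               ≡⟨ ^-distribˡ-+-* 8 q (r * 16) ⟩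
        8 ^ q * 8 ^ (r * 16)                           ≡⟨ cong (λ z → 8 ^ q * 8 ^ z) (*-comm r 16) ⟩
        8 ^ q * 8 ^ (16 * r)                           ≡⟨ cong (8 ^ q *_) (^-*-assoc 8 16 r) ⟨
        8 ^ q * (8 ^ 16) ^ r                           ≤⟨ *-mono-≤ (^-monoˡ-≤ q (toWitness {a? = 8 ≤? 7 * 2} _)) (^-monoˡ-≤ r 8^16≤) ⟩
        (7 * 2) ^ q * (7 ^ 15 * 2 ^ 7) ^ r             ≡⟨ cong₂ _*_ (^-distribʳ-* q 7 2) (^-distribʳ-* r (7 ^ 15) (2 ^ 7)) ⟩
        7 ^ q * 2 ^ q * ((7 ^ 15) ^ r * (2 ^ 7) ^ r) ∎
      t≤ : t ≤ 2 ^ q * (2 ^ 7) ^ r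
      t≤ = *-cancelˡ-≤ (7 ^ n) {{m^n≢0 7 n}} (begin
        7 ^ n * t                                               ≤⟨ card-high n r ⟩
        7 ^ r * 8 ^ n                                           ≤⟨ *-monoʳ-≤ (7 ^ r) 8^n≤ ⟩
        7 ^ r * (7 ^ q * 2 ^ q * ((7 ^ 15) ^ r * (2 ^ 7) ^ r))  ≡⟨ shuffle (7 ^ r) (7 ^ q) (2 ^ q) ((7 ^ 15) ^ r) ((2 ^ 7) ^ r) ⟩
        7 ^ q * (7 ^ r * (7 ^ 15) ^ r) * (2 ^ q * (2 ^ 7) ^ r)  ≡⟨ cong (λ z → 7 ^ q * z * (2 ^ q * (2 ^ 7) ^ r)) (pow 7 r) ⟩
        7 ^ q * 7 ^ (r * 16) * (2 ^ q * (2 ^ 7) ^ r)            ≡⟨ cong (_* (2 ^ q * (2 ^ 7) ^ r)) (^-distribˡ-+-* 7 q (r * 16)) ⟨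
        7 ^ (q + r * 16) * (2 ^ q * (2 ^ 7) ^ r)                ≡⟨ cong (λ z → 7 ^ z * (2 ^ q * (2 ^ 7) ^ r)) n≡ ⟨
        7 ^ n * (2 ^ q * (2 ^ 7) ^ r) ∎)

  -- Rooted tree posets

  ⊑⇒⊆ : ∀ {n} (F H : Subset n) → (F ⊑ H) ≡ true → F ⊆ H
  ⊑⇒⊆ []          []          eq = id
  ⊑⇒⊆ (true ∷ F)  (true ∷ H)  eq = s⊆s (⊑⇒⊆ F H eq)
  ⊑⇒⊆ (false ∷ F) (h ∷ H)     eq = out⊆ (⊑⇒⊆ F H eq)

  ⊆⇒⊑ : ∀ {n} (F H : Subset n) → F ⊆ H → (F ⊑ H) ≡ true
  ⊆⇒⊑ []          []          F⊆H = refl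
  ⊆⇒⊑ (true ∷ F)  (true ∷ H)  F⊆H = ⊆⇒⊑ F H (drop-∷-⊆ F⊆H)
  ⊆⇒⊑ (true ∷ F)  (false ∷ H) F⊆H with F⊆H Vec.here
  ... | ()
  ⊆⇒⊑ (false ∷ F) (h ∷ H)     F⊆H = ⊆⇒⊑ F H (drop-∷-⊆ F⊆H)

  ⊆∧≢⇒∣∣< : ∀ {n} {F H : Subset n} → F ⊆ H → F ≢ H → ∣ F ∣ < ∣ H ∣
  ⊆∧≢⇒∣∣< {F = F} {H} F⊆H F≢H = go F H (⊆⇒⊑ F H F⊆H) F≢H
    where
    go : ∀ {n} (F H : Subset n) → (F ⊑ H) ≡ true → F ≢ H → ∣ F ∣ < ∣ H ∣
    go []          []          eq ne = ⊥-elim (ne refl)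
    go (true ∷ F)  (true ∷ H)  eq ne = s≤s (go F H eq (ne ∘ cong (true ∷_)))
    go (false ∷ F) (true ∷ H)  eq ne = s≤s (p⊆q⇒∣p∣≤∣q∣ (⊑⇒⊆ F H eq))
    go (false ∷ F) (false ∷ H) eq ne = go F H eq (ne ∘ cong (false ∷_))

  -- Inclusion-exclusion, with `A` inside the intersection.
  ∣∪∣-bound : ∀ {n} (A B E : Subset n) → A ⊆ B → A ⊆ E → ∣ B ∪ E ∣ + ∣ A ∣ ≤ ∣ B ∣ + ∣ E ∣
  ∣∪∣-bound A B E A⊆B A⊆E = go A B E (⊆⇒⊑ A B A⊆B) (⊆⇒⊑ A E A⊆E)
    where
    step : ∀ {x y z w} → x + y ≤ z + w → x + suc y ≤ z + suc w
    step {x} {y} {z} {w} le = subst₂ _≤_ (sym (+-suc x y)) (sym (+-suc z w)) (s≤s le)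
    go : ∀ {n} (A B E : Subset n) → (A ⊑ B) ≡ true → (A ⊑ E) ≡ true → ∣ B ∪ E ∣ + ∣ A ∣ ≤ ∣ B ∣ + ∣ E ∣
    go []          []          []          p q = z≤n
    go (true ∷ A)  (true ∷ B)  (true ∷ E)  p q = s≤s (step (go A B E p q))
    go (false ∷ A) (true ∷ B)  (true ∷ E)  p q = s≤s (≤-trans (go A B E p q) (+-monoʳ-≤ ∣ B ∣ (n≤1+n ∣ E ∣)))
    go (false ∷ A) (true ∷ B)  (false ∷ E) p q = s≤s (go A B E p q)
    go (false ∷ A) (false ∷ B) (true ∷ E)  p q = ≤-trans (s≤s (go A B E p q)) (≤-reflexive (sym (+-suc ∣ B ∣ ∣ E ∣)))
    go (false ∷ A) (false ∷ B) (false ∷ E) p q = go A B E p q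

  ⋃⊆ : ∀ {n} {B : Subset n} xs → All (_⊆ B) xs → ⋃ xs ⊆ B
  ⋃⊆ List.[]       All.[]       x∈ = ⊥-elim (∉⊥ x∈)
  ⋃⊆ (E List.∷ xs) (E⊆ All.∷ a) x∈ with x∈p∪q⁻ E (⋃ xs) x∈
  ... | inj₁ x∈E = E⊆ x∈E
  ... | inj₂ x∈⋃ = ⋃⊆ xs a x∈⋃

  ⊆⋂ : ∀ {n} {A : Subset n} xs → All (A ⊆_) xs → A ⊆ ⋂ xs
  ⊆⋂ List.[]       All.[]       x∈ = ∈⊤
  ⊆⋂ (E List.∷ xs) (⊆E All.∷ a) x∈ = x∈p∩q⁺ (⊆E x∈ , ⊆⋂ xs a x∈)

  -- All sets lie in an interval of dimension at most `g`, which bounds the spread by `g`.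
  -- Complementation merely exchanges the two ends, so the notion serves both orientations of the
  -- tree.
  Between : ∀ {n s} → (Fin s → Subset n) → ℕ → Set
  Between E g = ∃ λ A → ∃ λ B → (∀ v → A ⊆ E v) × (∀ v → E v ⊆ B) × ∣ B ∣ ≤ ∣ A ∣ + g

  spread≤ : ∀ {T n} {F : Family n} (c : Copy T F) {g} → Between (emb c) g → spread T c ≤ g
  spread≤ c {g} (A , B , A⊆ , ⊆B , ∣B∣≤) = m≤n+o⇒m∸n≤o _ _ (begin
    ∣ ⋃ (List.tabulate (emb c)) ∣        ≤⟨ p⊆q⇒∣p∣≤∣q∣ (⋃⊆ _ (tabulate⁺ ⊆B)) ⟩
    ∣ B ∣                                ≤⟨ ∣B∣≤ ⟩
    ∣ A ∣ + g                            ≤⟨ +-monoˡ-≤ g (p⊆q⇒∣p∣≤∣q∣ (⊆⋂ _ (tabulate⁺ A⊆))) ⟩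
    ∣ ⋂ (List.tabulate (emb c)) ∣ + g ∎)
    where open ≤-Reasoning

  Between-∁ : ∀ {n s} (E : Fin s → Subset n) {g} → Between (∁ ∘ E) g → Between E g
  Between-∁ {n} E {g} (A , B , A⊆ , ⊆B , ∣B∣≤) = ∁ B , ∁ A ,
    (λ v x∈ → x∉∁p⇒x∈p λ x∈∁ → x∈∁p⇒x∉p x∈ (⊆B v x∈∁)) ,
    (λ v x∈ → x∉p⇒x∈∁p λ x∈A → x∈∁p⇒x∉p (A⊆ v x∈A) x∈) ,
    (begin
      ∣ ∁ A ∣             ≡⟨ ∣∁p∣≡n∸∣p∣ A ⟩
      n ∸ ∣ A ∣           ≤⟨ m≤n+o⇒m∸n≤o n ∣ A ∣ (begin
        n                                ≡⟨ m∸n+n≡m (∣p∣≤n B) ⟨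
        n ∸ ∣ B ∣ + ∣ B ∣                ≤⟨ +-monoʳ-≤ (n ∸ ∣ B ∣) ∣B∣≤ ⟩
        n ∸ ∣ B ∣ + (∣ A ∣ + g)          ≡⟨ rearrange (n ∸ ∣ B ∣) ∣ A ∣ g ⟩
        ∣ A ∣ + (n ∸ ∣ B ∣ + g) ∎) ⟩
      n ∸ ∣ B ∣ + g       ≡⟨ cong (_+ g) (∣∁p∣≡n∸∣p∣ B) ⟨
      ∣ ∁ B ∣ + g ∎)
    where
    open ≤-Reasoning
    rearrange : ∀ x y z → x + (y + z) ≡ y + (x + z)
    rearrange = solve-∀

  ∁-injective : ∀ {n} {p q : Subset n} → ∁ p ≡ ∁ q → p ≡ q
  ∁-injective eq = ⊆-antisym (∁p⊆∁q⇒p⊇q (⊆-reflexive (sym eq))) (∁p⊆∁q⇒p⊇q (⊆-reflexive eq))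

  module _ (T : FinPoset) where
    open FinPoset T
    open IsPartialOrder isPartialOrder using () renaming (refl to ≼-refl; trans to ≼-trans)

    private
      V : Set
      V = Fin size

    ⋖⁺⇒≼ : ∀ {p q} → Star (Covers T) p q → p ≼ q
    ⋖⁺⇒≼ ε                    = ≼-refl
    ⋖⁺⇒≼ (((p≼y , _) , _) ◅ w) = ≼-trans p≼y (⋖⁺⇒≼ w)

    -- The order relation need not be decidable, but inclusion is, so the inclusion can be proved by contradiction.
    covers-monotone : ∀ {m} (E : V → Subset m) → Injective _≡_ _≡_ E → (∀ p q → p ≼ q → E p ⊆ E q) →
                      ∀ {n} (f : V → Subset n) → (∀ p q → Covers T p q → f p ⊆ f q) →
                      ∀ p q → p ≼ q → f p ⊆ f q
    covers-monotone E E-inj E-mono f f-cov p q p≼q = go ∣ E q ∣ p q p≼q (m≤n+m _ ∣ E p ∣)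
      where
      E< : ∀ {p q} → _≺ₛ_ T p q → ∣ E p ∣ < ∣ E q ∣
      E< {p} {q} (p≼q , p≢q) = ⊆∧≢⇒∣∣< (E-mono p q p≼q) (p≢q ∘ E-inj)
      -- `k` bounds the difference of the sizes of `E q` and `E p`. An element strictly between p
      -- and q splits this difference into two smaller ones.
      go : ∀ k p q → p ≼ q → ∣ E q ∣ ≤ ∣ E p ∣ + k → f p ⊆ f q
      go k p q p≼q le with p Fin.≟ q
      ... | yes refl = ⊆-refl
      go zero    p q p≼q le | no p≢q = ⊥-elim (<⇒≱ (E< (p≼q , p≢q)) (≤-trans le (≤-reflexive (+-identityʳ _))))
      -- If the inclusion failed, then by induction no element could lie strictly between p and q;
      -- so q would cover p, where the inclusion is given.
      go (suc k) p q p≼q le | no p≢q = decidable-stable (f p ⊆? f q) λ ⊈ → ⊈ (f-cov p q ((p≼q , p≢q) ,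
        λ (z , p≺z , z≺q) → ⊈ (⊆-trans
          (go k p z (proj₁ p≺z) (s≤s⁻¹ (≤-trans (E< z≺q) (≤-trans le (≤-reflexive (+-suc ∣ E p ∣ k))))))
          (go k z q (proj₁ z≺q) (≤-trans le (≤-trans (≤-reflexive (+-suc ∣ E p ∣ k)) (+-monoˡ-≤ k (E< p≺z))))))))

  unsnoc : ∀ {A : Set} {R : A → A → Set} {x z} → Star R x z → x ≡ z ⊎ ∃ λ y → Star R x y × R y z
  unsnoc ε = inj₁ refl
  unsnoc (r ◅ rs) with unsnoc rs
  ... | inj₁ refl           = inj₂ (_ , ε , r)
  ... | inj₂ (y , rs′ , r′) = inj₂ (y , r ◅ rs′ , r′)

  module UpwardTree (T : FinPoset) (connected : HasseConnected T) (upward : UpwardMonotone T)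
                    (v₀ : Fin (FinPoset.size T)) where
    open FinPoset T public
    open IsPartialOrder isPartialOrder using (antisym) renaming (refl to ≼-refl; trans to ≼-trans)

    V : Set
    V = Fin size

    _⋖_ _⋖*_ : V → V → Set
    _⋖_ = Covers T
    _⋖*_ = Star _⋖_

    -- Upward monotonicity cancels every peak of a walk in the Hasse diagram.
    meet : ∀ {p q} → Star (HasseAdj T) p q → ∃ λ z → z ⋖* p × z ⋖* q
    meet ε = _ , ε , ε
    meet (inj₂ y⋖p ◅ w) with meet w
    ... | z , z⋖*y , z⋖*q = z , z⋖*y ◅◅ (y⋖p ◅ ε) , z⋖*q
    meet (inj₁ p⋖y ◅ w) with meet w
    ... | z , z⋖*y , z⋖*q with unsnoc z⋖*y
    ...   | inj₁ refl = _ , ε , p⋖y ◅ z⋖*q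
    ...   | inj₂ (y′ , z⋖*y′ , y′⋖y) with upward _ _ _ y′⋖y p⋖y
    ...     | refl = z , z⋖*y′ , z⋖*q

    rooted : ∃ λ r → ∀ v → r ⋖* v
    rooted with below (List.allFin size)
      where
      below : ∀ vs → ∃ λ r → ∀ v → v ∈ₗ vs → r ⋖* v
      below List.[] = v₀ , λ v ()
      below (w List.∷ vs) with below vs
      ... | r , r⋖* with meet (connected r w)
      ...   | z , z⋖*r , z⋖*w = z , λ { v (here refl) → z⋖*w ; v (there v∈) → z⋖*r ◅◅ r⋖* v v∈ }
    ... | r , r⋖* = r , λ v → r⋖* v (∈-allFin v)

    root : V
    root = proj₁ rooted

    root⋖* : ∀ v → root ⋖* v
    root⋖* = proj₂ rooted

    root-minimal : ∀ {y} → ¬ (y ⋖ root)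
    root-minimal {y} ((y≼r , y≢r) , _) = y≢r (antisym y≼r (⋖⁺⇒≼ T (root⋖* y)))

    data Path : V → Set where
      top  : Path root
      step : ∀ {y v} → y ⋖ v → Path y → Path v

    extend : ∀ {y v} → Path y → y ⋖* v → Path v
    extend p ε       = p
    extend p (c ◅ w) = extend (step c p) w

    path : ∀ v → Path v
    path v = extend top (root⋖* v)

    -- In a tree rooted at its minimum this is the principal downset of v. It is read off a path
    -- because `_≼_` carries no decision procedure to filter by.
    vertices : ∀ {v} → Path v → Subset size
    vertices top                = ⁅ root ⁆
    vertices (step {v = v} c p) = ⁅ v ⁆ ∪ vertices p

    depth : ∀ {v} → Path v → ℕ
    depth top        = 0
    depth (step _ p) = suc (depth p)

    chain : ∀ {v} (p : Path v) → Fin (suc (depth p)) → V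
    chain {v} p          zero    = v
    chain     (step _ p) (suc i) = chain p i

    chain-≼ : ∀ {v} (p : Path v) i → chain p i ≼ v
    chain-≼ p          zero    = ≼-refl
    chain-≼ (step c p) (suc i) = ≼-trans (chain-≼ p i) (proj₁ (proj₁ c))

    chain-isChain : ∀ {v} (p : Path v) → IsChain T (suc (depth p)) (chain p)
    chain-isChain {v} p = injective′ p , comparable p
      where
      absurd : ∀ {y v} (c : y ⋖ v) (p : Path y) i → v ≢ chain p i
      absurd c p i refl = proj₂ (proj₁ c) (antisym (proj₁ (proj₁ c)) (chain-≼ p i))
      injective′ : ∀ {v} (p : Path v) → Injective _≡_ _≡_ (chain p)
      injective′ p          {zero}  {zero}  eq = refl
      injective′ (step c p) {suc i} {suc j} eq = cong suc (injective′ p eq)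
      injective′ (step c p) {zero}  {suc j} eq = ⊥-elim (absurd c p j eq)
      injective′ (step c p) {suc i} {zero}  eq = ⊥-elim (absurd c p i (sym eq))
      comparable : ∀ {v} (p : Path v) i j → chain p i ≼ chain p j ⊎ chain p j ≼ chain p i
      comparable p          zero    j       = inj₂ (chain-≼ p j)
      comparable p          (suc i) zero    = inj₁ (chain-≼ p (suc i))
      comparable (step c p) (suc i) (suc j) = comparable p i j

    vertices-≼ : ∀ {v w} (p : Path v) → w ∈ vertices p → w ≼ v
    vertices-≼ top w∈ rewrite x∈⁅y⁆⇒x≡y root w∈ = ≼-refl
    vertices-≼ (step {v = v} c p) w∈ with x∈p∪q⁻ ⁅ v ⁆ (vertices p) w∈
    ... | inj₁ w∈v rewrite x∈⁅y⁆⇒x≡y v w∈v = ≼-refl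
    ... | inj₂ w∈p = ≼-trans (vertices-≼ p w∈p) (proj₁ (proj₁ c))

    end∈vertices : ∀ {v} (p : Path v) → v ∈ vertices p
    end∈vertices top                = x∈⁅x⁆ root
    end∈vertices (step {v = v} c p) = p⊆p∪q (vertices p) (x∈⁅x⁆ v)

    ∣vertices∣ : ∀ {v} (p : Path v) → ∣ vertices p ∣ ≤ suc (depth p)
    ∣vertices∣ top                = ≤-reflexive (∣⁅x⁆∣≡1 root)
    ∣vertices∣ (step {v = v} c p) = begin
      ∣ ⁅ v ⁆ ∪ vertices p ∣                        ≤⟨ m≤m+n _ ∣ ⊥ {size} ∣ ⟩
      ∣ ⁅ v ⁆ ∪ vertices p ∣ + ∣ ⊥ {size} ∣         ≤⟨ ∣∪∣-bound ⊥ ⁅ v ⁆ (vertices p) ⊥⊆ ⊥⊆ ⟩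
      ∣ ⁅ v ⁆ ∣ + ∣ vertices p ∣                    ≤⟨ +-mono-≤ (≤-reflexive (∣⁅x⁆∣≡1 v)) (∣vertices∣ p) ⟩
      suc (suc (depth p)) ∎
      where open ≤-Reasoning

    -- Paths contain proofs of covering and need not be equal, so only their vertex sets are
    -- compared. Parents are unique by `upward`, and `root-minimal` excludes a step below the root.
    vertices-mono : ∀ {y v} (p : Path y) (q : Path v) → y ⋖ v → vertices p ⊆ vertices q
    vertices-unique : ∀ {v} (p q : Path v) → vertices p ⊆ vertices q
    vertices-mono p top c = ⊥-elim (root-minimal c)
    vertices-mono p (step {v = v} c′ q) c with upward _ _ _ c c′
    ... | refl = q⊆p∪q ⁅ v ⁆ (vertices q) ∘ vertices-unique p q
    vertices-unique top        q = λ x∈ → subst (_∈ vertices q) (sym (x∈⁅y⁆⇒x≡y root x∈)) (end∈vertices q)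
    vertices-unique (step {v = v} c p) q x∈ with x∈p∪q⁻ ⁅ v ⁆ (vertices p) x∈
    ... | inj₁ x∈v = subst (_∈ vertices q) (sym (x∈⁅y⁆⇒x≡y v x∈v)) (end∈vertices q)
    ... | inj₂ x∈p = vertices-mono p q c x∈p

    -- The additional element lies in no downset. It keeps all complements nonempty, so that in the
    -- dual case they too fit into `levels`, which never contains the empty set.
    downset : V → Subset (suc size)
    downset v = false ∷ vertices (path v)

    downset-injective : Injective _≡_ _≡_ downset
    downset-injective {v} {w} eq = antisym
      (vertices-≼ (path w) (subst (v ∈_) (drop-∷ eq) (end∈vertices (path v))))
      (vertices-≼ (path v) (subst (w ∈_) (sym (drop-∷ eq)) (end∈vertices (path w))))
      where
      drop-∷ : ∀ {x : Bool} {n} {p q : Subset n} → x ∷ p ≡ x ∷ q → p ≡ q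
      drop-∷ refl = refl

    downset-covers : ∀ p q → p ⋖ q → downset p ⊆ downset q
    downset-covers p q c = out⊆ (vertices-mono (path p) (path q) c)

    ∣downset∣>0 : ∀ v → 0 < ∣ downset v ∣
    ∣downset∣>0 v = ≤-trans (≤-reflexive (sym (∣⁅x⁆∣≡1 v)))
      (p⊆q⇒∣p∣≤∣q∣ λ x∈ → subst (_∈ vertices (path v)) (sym (x∈⁅y⁆⇒x≡y v x∈)) (end∈vertices (path v)))

    ∣downset∣≤ : ∀ {h} → IsHeight T h → ∀ v → ∣ downset v ∣ ≤ h
    ∣downset∣≤ (_ , largest) v = ≤-trans (∣vertices∣ (path v)) (largest _ (chain (path v) , chain-isChain (path v)))

  -- Lists and fresh choices

  AllPairs-lookup : ∀ {A : Set} {R : A → A → Set} {xs} → AllPairs R xs →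
                    ∀ {i j} → i Fin.< j → R (List.lookup xs i) (List.lookup xs j)
  AllPairs-lookup (r AllPairs.∷ rs) {zero}  {suc j} _         = All.lookup r (∈-lookup j)
  AllPairs-lookup (r AllPairs.∷ rs) {suc i} {suc j} (s≤s i<j) = AllPairs-lookup rs i<j

  Unique⇒length≤ : ∀ {A : Set} {xs ys : List A} → Unique xs → (∀ {x} → x ∈ₗ xs → x ∈ₗ ys) →
                   List.length xs ≤ List.length ys
  Unique⇒length≤ {xs = xs} {ys} unique xs⊆ys = Fin.injective⇒≤ {f = position} position-injective
    where
    position : Fin (List.length xs) → Fin (List.length ys)
    position i = Any.index (xs⊆ys (∈-lookup i))
    position-injective : Injective _≡_ _≡_ position
    position-injective {i} {j} eq with trans (lookup-index (xs⊆ys (∈-lookup i)))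
      (trans (cong (List.lookup ys) eq) (sym (lookup-index (xs⊆ys (∈-lookup j))))) | Fin.<-cmp i j
    ... | same | tri< i<j _ _ = ⊥-elim (AllPairs-lookup unique i<j same)
    ... | same | tri≈ _ i≡j _ = i≡j
    ... | same | tri> _ _ j<i = ⊥-elim (AllPairs-lookup unique j<i (sym same))

  module _ {A : Set} (_≟ₐ_ : DecidableEquality A) (near : A → List A) where
    open DecMembership _≟ₐ_ using (_∈?_)

    length-∈+∉ : ∀ ys xs → List.length xs ≡ List.length (List.filter (_∈? ys) xs) + List.length (List.filter (¬? ∘ (_∈? ys)) xs)
    length-∈+∉ ys List.[]       = refl
    length-∈+∉ ys (x List.∷ xs) with x ∈? ys
    ... | yes _ = cong suc (length-∈+∉ ys xs)
    ... | no  _ = trans (cong suc (length-∈+∉ ys xs)) (sym (+-suc (List.length (List.filter (_∈? ys) xs)) _))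

    -- Greedy selection: each element kept deletes the at most `K` later ones near it, so at least
    -- one in `suc K` is kept. Only the earlier element of a pair is asked for its neighbours, so
    -- `near` may be asymmetric.
    thin : ∀ K → (∀ x → List.length (near x) ≤ K) → ∀ xs → Unique xs →
           ∃ λ ys → List.length xs ≤ suc K * List.length ys
                  × AllPairs (λ x y → y ∉ near x) ys × (∀ {y} → y ∈ₗ ys → y ∈ₗ xs)
    thin K near≤ xs unique = go (List.length xs) xs ≤-refl unique
      where
      open ≤-Reasoning
      go : ∀ k xs → List.length xs ≤ k → Unique xs →
           ∃ λ ys → List.length xs ≤ suc K * List.length ys
                  × AllPairs (λ x y → y ∉ near x) ys × (∀ {y} → y ∈ₗ ys → y ∈ₗ xs)
      go k       List.[]       _         _                   = List.[] , z≤n , AllPairs.[] , id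
      go (suc k) (x List.∷ xs) (s≤s len) (_ AllPairs.∷ unique) =
        let rest = List.filter (¬? ∘ (_∈? near x)) xs
            dropped = List.filter (_∈? near x) xs
            split = length-∈+∉ (near x) xs
            ys , count , apart , ys⊆ = go k rest
              (≤-trans (m≤n+m _ (List.length dropped)) (≤-trans (≤-reflexive (sym split)) len))
              (Unique.filter⁺ (¬? ∘ (_∈? near x)) unique)
            dropped≤ = ≤-trans (Unique⇒length≤ {ys = near x} (Unique.filter⁺ (_∈? near x) unique)
                                 (λ y∈ → proj₂ (∈-filter⁻ (_∈? near x) {xs = xs} y∈))) (near≤ x)
        in x List.∷ ys
         , (begin
             suc (List.length xs)                              ≡⟨ cong suc split ⟩
             suc (List.length dropped + List.length rest)      ≤⟨ s≤s (+-mono-≤ dropped≤ count) ⟩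
             suc K + suc K * List.length ys                    ≡⟨ *-suc (suc K) (List.length ys) ⟨
             suc K * suc (List.length ys) ∎)
         , (All.tabulate (λ y∈ → proj₂ (∈-filter⁻ (¬? ∘ (_∈? near x)) {xs = xs} (ys⊆ y∈))) AllPairs.∷ apart)
         , λ { (here refl) → here refl
             ; (there y∈)  → there (proj₁ (∈-filter⁻ (¬? ∘ (_∈? near x)) {xs = xs} (ys⊆ y∈))) }

  vectors : ∀ {A : Set} m → List A → List (Vec A m)
  vectors zero    xs = [] List.∷ List.[]
  vectors (suc m) xs = List.cartesianProductWith _∷_ xs (vectors m xs)

  length-vectors : ∀ {A : Set} m (xs : List A) → List.length (vectors m xs) ≡ List.length xs ^ m
  length-vectors zero    xs = refl
  length-vectors {A} (suc m) xs = trans (product xs) (cong (List.length xs *_) (length-vectors m xs))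
    where
    product : ∀ (xs′ : List A) → List.length (List.cartesianProductWith Vec._∷_ xs′ (vectors m xs)) ≡
                                 List.length xs′ * List.length (vectors m xs)
    product List.[]        = refl
    product (x List.∷ xs′) = trans (length-++ (List.map (x ∷_) (vectors m xs)))
      (cong₂ _+_ (length-map (x ∷_) (vectors m xs)) (product xs′))

  ∈-vectors : ∀ {A : Set} {m} {xs : List A} (α : Vec A m) → (∀ i → lookup α i ∈ₗ xs) → α ∈ₗ vectors m xs
  ∈-vectors []      _  = here refl
  ∈-vectors (a ∷ α) α∈ = ∈-cartesianProductWith⁺ _∷_ (α∈ zero) (∈-vectors α (α∈ ∘ suc))

  module _ {A : Set} where
    extensions : ∀ {m} → (Vec A m → List A) → List (Vec A m) → List (Vec A (suc m))
    extensions f List.[]       = List.[]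
    extensions f (α List.∷ αs) = List.map (_∷ α) (f α) List.++ extensions f αs

    ∈-extensions⁻ : ∀ {m} (f : Vec A m → List A) αs {a α} → (a ∷ α) ∈ₗ extensions f αs → α ∈ₗ αs × a ∈ₗ f α
    ∈-extensions⁻ f (α′ List.∷ αs) α∈ with ∈-++⁻ (List.map (_∷ α′) (f α′)) α∈
    ... | inj₂ α∈ext = let α∈αs , a∈ = ∈-extensions⁻ f αs α∈ext in there α∈αs , a∈
    ... | inj₁ α∈map with ∈-map⁻ (_∷ α′) α∈map
    ...   | _ , a∈ , refl = here refl , a∈

    extensions-unique : ∀ {m} (f : Vec A m → List A) {αs} → Unique αs → (∀ α → Unique (f α)) → Unique (extensions f αs)
    extensions-unique f AllPairs.[] f-unique = AllPairs.[]
    extensions-unique f {α List.∷ αs} (α∉ AllPairs.∷ unique) f-unique =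
      Unique.++⁺ (Unique.map⁺ (cong Vec.head) (f-unique α)) (extensions-unique f unique f-unique) disjoint
      where
      disjoint : ∀ {β} → ¬ (β ∈ₗ List.map (_∷ α) (f α) × β ∈ₗ extensions f αs)
      disjoint (β∈map , β∈ext) with ∈-map⁻ (_∷ α) β∈map
      ... | _ , _ , refl = All.lookup α∉ (proj₁ (∈-extensions⁻ f αs β∈ext)) refl

    length-extensions : ∀ {m} (f : Vec A m → List A) c k αs → (∀ α → α ∈ₗ αs → c ≤ k * List.length (f α)) →
                        c * List.length αs ≤ k * List.length (extensions f αs)
    length-extensions f c k List.[]       c≤ = ≤-trans (≤-reflexive (*-zeroʳ c)) z≤n
    length-extensions f c k (α List.∷ αs) c≤ = begin
      c * suc (List.length αs)                                      ≡⟨ *-suc c (List.length αs) ⟩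
      c + c * List.length αs                                        ≤⟨ +-mono-≤ (c≤ α (here refl)) (length-extensions f c k αs (λ β → c≤ β ∘ there)) ⟩
      k * List.length (f α) + k * List.length (extensions f αs)     ≡⟨ *-distribˡ-+ k (List.length (f α)) _ ⟨
      k * (List.length (f α) + List.length (extensions f αs))       ≡⟨ cong (λ z → k * (z + List.length (extensions f αs))) (length-map (_∷ α) (f α)) ⟨
      k * (List.length (List.map (_∷ α) (f α)) + List.length (extensions f αs))
        ≡⟨ cong (k *_) (length-++ (List.map (_∷ α) (f α))) ⟨
      k * List.length (extensions f (α List.∷ αs)) ∎
      where open ≤-Reasoning

  allSets-unique : ∀ n → Unique (allSets n)
  allSets-unique zero    = All.[] AllPairs.∷ AllPairs.[]
  allSets-unique (suc n) = Unique.++⁺ (Unique.map⁺ (cong Vec.tail) (allSets-unique n))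
                                      (Unique.map⁺ (cong Vec.tail) (allSets-unique n)) disjoint
    where
    disjoint : ∀ {X} → ¬ (X ∈ₗ List.map (true ∷_) (allSets n) × X ∈ₗ List.map (false ∷_) (allSets n))
    disjoint (X∈₁ , X∈₂) with ∈-map⁻ (true ∷_) X∈₁ | ∈-map⁻ (false ∷_) X∈₂
    ... | _ , _ , refl | _ , _ , ()

  members : ∀ {n} → Family n → List (Subset n)
  members {n} G = List.filter (λ X → G X Bool.≟ true) (allSets n)

  ∈-members⁻ : ∀ {n} (G : Family n) {X} → X ∈ₗ members G → G X ≡ true
  ∈-members⁻ {n} G X∈ = proj₂ (∈-filter⁻ (λ X → G X Bool.≟ true) {xs = allSets n} X∈)

  members-unique : ∀ {n} (G : Family n) → Unique (members G)
  members-unique {n} G = Unique.filter⁺ (λ X → G X Bool.≟ true) (allSets-unique n)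

  card-mono : ∀ {n} {G H : Family n} → (∀ X → G X ≡ true → H X ≡ true) → card G ≤ card H
  card-mono {G = G} {H} G⊆H = begin
    card G               ≡⟨ card≡∑ G ⟩
    ∑ (λ X → ⟦ G X ⟧)    ≤⟨ ∑-mono pointwise ⟩
    ∑ (λ X → ⟦ H X ⟧)    ≡⟨ card≡∑ H ⟨
    card H ∎
    where
    open ≤-Reasoning
    pointwise : ∀ X → ⟦ G X ⟧ ≤ ⟦ H X ⟧
    pointwise X with G X in eq
    ... | false = z≤n
    ... | true  = ≤-reflexive (sym (cong ⟦_⟧ (G⊆H X eq)))

  same : ∀ {n} → Subset n → Subset n → Bool
  same []          []          = true
  same (true ∷ F)  (true ∷ H)  = same F H
  same (true ∷ F)  (false ∷ H) = false
  same (false ∷ F) (true ∷ H)  = false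
  same (false ∷ F) (false ∷ H) = same F H

  same-refl : ∀ {n} (F : Subset n) → same F F ≡ true
  same-refl []          = refl
  same-refl (true ∷ F)  = same-refl F
  same-refl (false ∷ F) = same-refl F

  ∑-same : ∀ {n} (F : Subset n) → ∑ (λ H → ⟦ same F H ⟧) ≡ 1
  ∑-same []          = refl
  ∑-same {suc n} (true ∷ F)  = cong₂ _+_ (∑-same F) (∑-* {n} 0 (λ _ → 0))
  ∑-same {suc n} (false ∷ F) = cong₂ _+_ (∑-* {n} 0 (λ _ → 0)) (∑-same F)

  fresh : ∀ {m n} → Vec (Subset n) m → Subset n → Bool
  fresh []      H = true
  fresh (A ∷ α) H = not (same A H) ∧ fresh α H

  fresh⇒≢ : ∀ {m n} (α : Vec (Subset n) m) {H} → fresh α H ≡ true → ∀ i → lookup α i ≢ H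
  fresh⇒≢ (A ∷ α) {H} eq zero    refl with same A A | same-refl A
  fresh⇒≢ (A ∷ α) {H} () zero    refl | true | _
  fresh⇒≢ (A ∷ α) {H} eq (suc i) = fresh⇒≢ α (proj₂ (∧-true {not (same A H)} eq)) i

  card-fresh : ∀ {m n} (α : Vec (Subset n) m) (G : Family n) → card G ≤ card (λ H → G H ∧ fresh α H) + m
  card-fresh {m} {n} α G = begin
    card G                                             ≡⟨ card≡∑ G ⟩
    ∑ (λ H → ⟦ G H ⟧)                                  ≤⟨ go α ⟩
    ∑ (λ H → ⟦ G H ∧ fresh α H ⟧) + m                  ≡⟨ cong (_+ m) (card≡∑ (λ H → G H ∧ fresh α H)) ⟨
    card (λ H → G H ∧ fresh α H) + m ∎
    where
    open ≤-Reasoning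
    pointwise : ∀ {m} A (α : Vec (Subset n) m) H → ⟦ G H ∧ fresh α H ⟧ ≤ ⟦ G H ∧ fresh (A ∷ α) H ⟧ + ⟦ same A H ⟧
    pointwise A α H with G H | same A H | fresh α H
    ... | false | _     | _     = z≤n
    ... | true  | true  | true  = ≤-refl
    ... | true  | true  | false = z≤n
    ... | true  | false | _     = m≤m+n _ 0
    go : ∀ {m} (α : Vec (Subset n) m) → ∑ (λ H → ⟦ G H ⟧) ≤ ∑ (λ H → ⟦ G H ∧ fresh α H ⟧) + m
    go [] = ≤-trans (∑-mono (λ H → ≤-reflexive (cong ⟦_⟧ (sym (Bool.∧-identityʳ (G H)))))) (m≤m+n _ 0)
    go {suc m} (A ∷ α) = begin
      ∑ (λ H → ⟦ G H ⟧)                                                     ≤⟨ go α ⟩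
      ∑ (λ H → ⟦ G H ∧ fresh α H ⟧) + m                                     ≤⟨ +-monoˡ-≤ m (∑-mono (pointwise A α)) ⟩
      ∑ (λ H → ⟦ G H ∧ fresh (A ∷ α) H ⟧ + ⟦ same A H ⟧) + m                ≡⟨ cong (_+ m) (∑-+ (λ H → ⟦ G H ∧ fresh (A ∷ α) H ⟧) _) ⟩
      ∑ (λ H → ⟦ G H ∧ fresh (A ∷ α) H ⟧) + ∑ (λ H → ⟦ same A H ⟧) + m      ≡⟨ cong (λ z → ∑ (λ H → ⟦ G H ∧ fresh (A ∷ α) H ⟧) + z + m) (∑-same A) ⟩
      ∑ (λ H → ⟦ G H ∧ fresh (A ∷ α) H ⟧) + 1 + m                           ≡⟨ +-assoc (∑ (λ H → ⟦ G H ∧ fresh (A ∷ α) H ⟧)) 1 m ⟩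
      ∑ (λ H → ⟦ G H ∧ fresh (A ∷ α) H ⟧) + suc m ∎

  above≡card : ∀ {n} (G : Family n) X → above G X ≡ card (λ H → G H ∧ (X ⊑ H))
  above≡card G X = trans (∑-cong pointwise) (sym (card≡∑ (λ H → G H ∧ (X ⊑ H))))
    where
    pointwise : ∀ H → ⟦ G H ⟧ * ⟦ X ⊑ H ⟧ ≡ ⟦ G H ∧ (X ⊑ H) ⟧
    pointwise H with G H | X ⊑ H
    ... | true  | true  = refl
    ... | true  | false = refl
    ... | false | _     = refl

  -- The 32 comes from n ≤ 32 r; the 2 in tower-ample pays for the sets that are not fresh, at most half of all once n is large.
  choiceConst : ℕ → ℕ → ℕ
  choiceConst β g = 32 ^ g * (β ^ g * g !)

  tower-ample : ∀ {n r} β (F : Family n) g j X m → n ≤ 32 * r → (∀ H → F H ≡ true → r ≤ co H) →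
                tower β F (suc g + j) X ≡ true → suc (2 * m * choiceConst β (suc g)) ≤ n →
                (α : Vec (Subset n) m) →
                n ^ suc g ≤ 2 * choiceConst β (suc g) * card (λ H → (tower β F j H ∧ (X ⊑ H)) ∧ fresh α H)
  tower-ample {n} {r} β F g′ j X m n≤32r r≤co X∈ n-large α = begin
    n ^ g               ≤⟨ n^g≤ ⟩
    κ * (c + m)         ≤⟨ *-monoʳ-≤ κ (+-monoʳ-≤ c m≤c) ⟩
    κ * (c + c)         ≡⟨ double κ c ⟩
    2 * κ * c ∎
    where
    open ≤-Reasoning
    g = suc g′
    κ = choiceConst β g
    G : Family n
    G H = tower β F j H ∧ (X ⊑ H)
    c = card (λ H → G H ∧ fresh α H)
    double : ∀ x y → x * (y + y) ≡ 2 * x * y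
    double = solve-∀
    n^g≤ : n ^ g ≤ κ * (c + m)
    n^g≤ = begin
      n ^ g                                            ≤⟨ ^-monoˡ-≤ g n≤32r ⟩
      (32 * r) ^ g                                     ≡⟨ ^-distribʳ-* g 32 r ⟩
      32 ^ g * r ^ g                                   ≤⟨ *-monoʳ-≤ (32 ^ g) (tower-above β F g j X r≤co X∈) ⟩
      32 ^ g * (β ^ g * g ! * above (tower β F j) X)   ≡⟨ *-assoc (32 ^ g) (β ^ g * g !) _ ⟨
      κ * above (tower β F j) X                        ≡⟨ cong (κ *_) (above≡card (tower β F j) X) ⟩
      κ * card G                                       ≤⟨ *-monoʳ-≤ κ (card-fresh α G) ⟩
      κ * (c + m) ∎
    -- The exponent is positive, so `n ≤ n ^ g`; at most `m` fresh choices would then force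
    -- `n ≤ 2 * m * κ`, against `n-large`.
    m≤c : m ≤ c
    m≤c with ≤-total m c
    ... | inj₁ m≤c = m≤c
    ... | inj₂ c≤m = ⊥-elim (<-irrefl refl (begin-strict
      n                  ≡⟨ *-identityʳ n ⟨
      n * 1              ≤⟨ *-monoʳ-≤ n (m^n>0 n {{>-nonZero (≤-trans (s≤s z≤n) n-large)}} g′) ⟩
      n ^ g              ≤⟨ n^g≤ ⟩
      κ * (c + m)        ≤⟨ *-monoʳ-≤ κ (+-monoˡ-≤ m c≤m) ⟩
      κ * (m + m)        ≡⟨ swap κ m ⟩
      2 * m * κ          <⟨ n-large ⟩
      n ∎))
      where
      swap : ∀ x y → x * (y + y) ≡ 2 * y * x
      swap = solve-∀

  -- Placing the vertices of the tree

  module Embedding (T : FinPoset) (connected : HasseConnected T) (upward : UpwardMonotone T)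
                   (v₀ : Fin (FinPoset.size T)) where
    open UpwardTree T connected upward v₀

    -- An order of placement, latest vertex first, in which every vertex except the root comes after
    -- its parent; `j` is the position of the parent.
    data Build : ∀ {m} → Vec V m → Set where
      base : Build (root ∷ [])
      add  : ∀ {m} {vs : Vec V m} → Build vs → (v : V) → (∀ i → lookup vs i ≢ v) →
             (j : Fin m) → lookup vs j ⋖ v → Build (v ∷ vs)

    _∈ᵥ_ : ∀ {m} → V → Vec V m → Set
    v ∈ᵥ vs = ∃ λ i → lookup vs i ≡ v

    Extension : ∀ {m} → Vec V m → (∀ {k} → Vec V k → Set) → Set
    Extension vs P = ∃₂ λ k (vs′ : Vec V k) → Build vs′ × (∀ {v} → v ∈ᵥ vs → v ∈ᵥ vs′) × P vs′

    add-chain : ∀ {m} {vs : Vec V m} {y v} → Build vs → y ∈ᵥ vs → y ⋖* v → Extension vs (v ∈ᵥ_)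
    add-chain b y∈ ε = _ , _ , b , id , y∈
    add-chain {vs = vs} b (j , refl) (_◅_ {j = w} c chain) with Fin.any? (λ i → lookup vs i Fin.≟ w)
    ... | yes w∈ = add-chain b w∈ chain
    ... | no  w∉ with add-chain (add b w (λ i eq → w∉ (i , eq)) j c) (zero , refl) chain
    ...   | _ , _ , b′ , ⊆′ , v∈ = _ , _ , b′ , (λ { (i , eq) → ⊆′ (suc i , eq) }) , v∈

    add-list : ∀ {m} {vs : Vec V m} → Build vs → root ∈ᵥ vs → (ws : List V) →
               Extension vs (λ vs′ → ∀ {w} → w ∈ₗ ws → w ∈ᵥ vs′)
    add-list b r∈ List.[] = _ , _ , b , id , λ ()
    add-list b r∈ (w List.∷ ws) with add-chain b r∈ (root⋖* w)
    ... | _ , _ , b₁ , ⊆₁ , w∈ with add-list b₁ (⊆₁ r∈) ws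
    ...   | _ , _ , b₂ , ⊆₂ , ws∈ = _ , _ , b₂ , ⊆₂ ∘ ⊆₁ , λ { (here refl) → ⊆₂ w∈ ; (there w′∈) → ws∈ w′∈ }

    build : ∃₂ λ m (vs : Vec V m) → Build vs × (∀ v → v ∈ᵥ vs)
    build with add-list base (zero , refl) (List.allFin size)
    ... | m , vs , b , _ , all∈ = m , vs , b , λ v → all∈ (∈-allFin v)

    build-injective : ∀ {m} {vs : Vec V m} → Build vs → Injective _≡_ _≡_ (lookup vs)
    build-injective base               {zero}  {zero}  eq = refl
    build-injective (add b v v∉ j c) {zero}  {zero}  eq = refl
    build-injective (add b v v∉ j c) {zero}  {suc i} eq = ⊥-elim (v∉ i (sym eq))
    build-injective (add b v v∉ j c) {suc i} {zero}  eq = ⊥-elim (v∉ i eq)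
    build-injective (add b v v∉ j c) {suc i} {suc k} eq = cong suc (build-injective b eq)

    -- E is a model copy, and ρ v is the distance from E v to a fixed level above the whole model.
    -- A vertex v will be placed in the ρ v-th tower of the given family.
    module _ {n₁} (E : V → Subset n₁) (E-injective : Injective _≡_ _≡_ E)
             (E-mono : ∀ p q → p ≼ q → E p ⊆ E q)
             (ρ : V → ℕ) (c₀ : ℕ) (∣E∣+ρ : ∀ v → ∣ E v ∣ + ρ v ≡ c₀) where

      ρ-anti : ∀ {y v} → y ⋖ v → ρ v < ρ y
      ρ-anti {y} {v} ((y≼v , y≢v) , _) = +-cancelˡ-< ∣ E y ∣ (ρ v) (ρ y) (begin-strict
        ∣ E y ∣ + ρ v   <⟨ +-monoˡ-< (ρ v) (⊆∧≢⇒∣∣< (E-mono y v y≼v) (y≢v ∘ E-injective)) ⟩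
        ∣ E v ∣ + ρ v   ≡⟨ trans (∣E∣+ρ v) (sym (∣E∣+ρ y)) ⟩
        ∣ E y ∣ + ρ y ∎)
        where open ≤-Reasoning

      -- One less than the number of levels between the two sets in the model, so that
      -- `suc (jump c)` shows the exponent to be positive, as `tower-ample` demands.
      jump : ∀ {y v} → y ⋖ v → ℕ
      jump {y} {v} _ = ρ y ∸ suc (ρ v)

      jump-ρ : ∀ {y v} (c : y ⋖ v) → suc (jump c) + ρ v ≡ ρ y
      jump-ρ {y} {v} c = trans (sym (+-suc (jump c) (ρ v))) (m∸n+n≡m (ρ-anti c))

      jumps : ∀ {m} {vs : Vec V m} → Build vs → ℕ
      jumps base            = 0
      jumps (add b v _ j c) = suc (jump c) + jumps b

      -- The set of the parent is already inside `B`, so joining `E v` enlarges `B` by at most the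
      -- difference of their sizes, which is the jump.
      build-between : ∀ {m} {vs : Vec V m} (b : Build vs) →
                      ∃ λ B → (∀ i → E (lookup vs i) ⊆ B) × ∣ B ∣ ≤ ∣ E root ∣ + jumps b
      build-between base = E root , (λ { zero → ⊆-refl }) , m≤m+n _ 0
      build-between (add {vs = vs} b v _ j c) with build-between b
      ... | B , ⊆B , ∣B∣≤ = B ∪ E v
          , (λ { zero → q⊆p∪q B (E v) ; (suc i) → ⊆-trans (⊆B i) (p⊆p∪q (E v)) })
          , +-cancelʳ-≤ ∣ E y ∣ _ _ (begin
              ∣ B ∪ E v ∣ + ∣ E y ∣                       ≤⟨ ∣∪∣-bound (E y) B (E v) (⊆B j) (E-mono y v (proj₁ (proj₁ c))) ⟩
              ∣ B ∣ + ∣ E v ∣                             ≤⟨ +-mono-≤ ∣B∣≤ (≤-reflexive ∣Ev∣) ⟩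
              ∣ E root ∣ + jumps b + (∣ E y ∣ + g)        ≡⟨ rearrange (∣ E root ∣) (jumps b) (∣ E y ∣) g ⟩
              ∣ E root ∣ + (g + jumps b) + ∣ E y ∣ ∎)
        where
        open ≤-Reasoning
        y = lookup vs j
        g = suc (jump c)
        rearrange : ∀ x y z w → x + y + (z + w) ≡ x + (w + y) + z
        rearrange = solve-∀
        ∣Ev∣ : ∣ E v ∣ ≡ ∣ E y ∣ + g
        ∣Ev∣ = +-cancelʳ-≡ (ρ v) _ _ (begin-equality
          ∣ E v ∣ + ρ v         ≡⟨ trans (∣E∣+ρ v) (sym (∣E∣+ρ y)) ⟩
          ∣ E y ∣ + ρ y         ≡⟨ cong (∣ E y ∣ +_) (jump-ρ c) ⟨
          ∣ E y ∣ + (g + ρ v)   ≡⟨ +-assoc ∣ E y ∣ g (ρ v) ⟨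
          ∣ E y ∣ + g + ρ v ∎)

      E-between : ∀ {m} {vs : Vec V m} (b : Build vs) → (∀ v → v ∈ᵥ vs) → Between E (jumps b)
      E-between {vs = vs} b all∈ with build-between b
      ... | B , ⊆B , ∣B∣≤ = E root , B , (λ v → E-mono root v (⋖⁺⇒≼ T (root⋖* v))) , E⊆B , ∣B∣≤
        where
        E⊆B : ∀ v → E v ⊆ B
        E⊆B v with all∈ v
        ... | i , refl = ⊆B i

      module _ (β : ℕ) where
        loss : ∀ {m} {vs : Vec V m} → Build vs → ℕ
        loss base            = 1
        loss (add b v _ j c) = 2 * choiceConst β (suc (jump c)) * loss b

        threshold : ∀ {m} {vs : Vec V m} → Build vs → ℕ
        threshold base                        = 0
        threshold (add {m = m} b v _ j c) = suc (2 * m * choiceConst β (suc (jump c))) + threshold b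

        module _ {n} (F : Family n) where
          admissible : ∀ {m} → V → Fin m → Vec (Subset n) m → Family n
          admissible v j α H = (tower β F (ρ v) H ∧ (lookup α j ⊑ H)) ∧ fresh α H

          assignments : ∀ {m} {vs : Vec V m} → Build vs → List (Vec (Subset n) m)
          assignments base            = List.map (_∷ []) (members (tower β F (ρ root)))
          assignments (add b v _ j c) = extensions (λ α → members (admissible v j α)) (assignments b)

          assignments-unique : ∀ {m} {vs : Vec V m} (b : Build vs) → Unique (assignments b)
          assignments-unique base            = Unique.map⁺ (cong Vec.head) (members-unique (tower β F (ρ root)))
          assignments-unique (add b v _ j c) =
            extensions-unique _ (assignments-unique b) (λ α → members-unique (admissible v j α))

          record Valid {m} (vs : Vec V m) (α : Vec (Subset n) m) : Set where
            field
              in-tower     : ∀ i → tower β F (ρ (lookup vs i)) (lookup α i) ≡ true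
              distinct     : Injective _≡_ _≡_ (lookup α)
              above-parent : ∀ i → lookup vs i ≡ root ⊎
                             ∃ λ j → lookup vs j ⋖ lookup vs i × lookup α j ⊆ lookup α i

          assignments-valid : ∀ {m} {vs : Vec V m} (b : Build vs) {α} → α ∈ₗ assignments b → Valid vs α
          assignments-valid base α∈ with ∈-map⁻ (_∷ []) α∈
          ... | X , X∈ , refl = record
            { in-tower     = λ { zero → ∈-members⁻ (tower β F (ρ root)) X∈ }
            ; distinct     = λ { {zero} {zero} _ → refl }
            ; above-parent = λ { zero → inj₁ refl } }
          assignments-valid (add {vs = vs} b v _ j c) {H ∷ α} Hα∈
            with ∈-extensions⁻ (λ α → members (admissible v j α)) (assignments b) Hα∈
          ... | α∈ , H∈ = record
            { in-tower     = λ { zero → proj₁ H-ok₁ ; (suc i) → in-tower i }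
            ; distinct     = λ { {zero}  {zero}  _  → refl
                               ; {zero}  {suc i} eq → ⊥-elim (fresh⇒≢ α (proj₂ H-ok) i (sym eq))
                               ; {suc i} {zero}  eq → ⊥-elim (fresh⇒≢ α (proj₂ H-ok) i eq)
                               ; {suc i} {suc k} eq → cong suc (distinct eq) }
            ; above-parent = λ { zero    → inj₂ (suc j , c , ⊑⇒⊆ (lookup α j) H (proj₂ H-ok₁))
                               ; (suc i) → earlier i } }
            where
            open Valid (assignments-valid b α∈)
            earlier : ∀ i → lookup vs i ≡ root ⊎ ∃ λ k → lookup (v ∷ vs) k ⋖ lookup vs i × lookup (H ∷ α) k ⊆ lookup α i
            earlier i with above-parent i
            ... | inj₁ eq            = inj₁ eq
            ... | inj₂ (k , c′ , ⊆′) = inj₂ (suc k , c′ , ⊆′)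
            H-ok : (tower β F (ρ v) H ∧ (lookup α j ⊑ H)) ≡ true × fresh α H ≡ true
            H-ok = ∧-true (∈-members⁻ (admissible v j α) H∈)
            H-ok₁ : tower β F (ρ v) H ≡ true × (lookup α j ⊑ H) ≡ true
            H-ok₁ = ∧-true (proj₁ H-ok)

          count-assignments : ∀ {r h} → ρ root ≤ h → n ≤ 32 * r → (∀ H → F H ≡ true → r ≤ co H) →
                              ∀ {m} {vs : Vec V m} (b : Build vs) → threshold b ≤ n →
                              n ^ jumps b * card (tower β F h) ≤ loss b * List.length (assignments b)
          count-assignments {r} {h} ρr≤h n≤32r r≤co base _ = begin
            1 * card (tower β F h)              ≤⟨ *-monoʳ-≤ 1 (card-mono (tower-anti β F ρr≤h)) ⟩
            1 * card (tower β F (ρ root))       ≡⟨ cong (1 *_) (length-map (_∷ []) (members (tower β F (ρ root)))) ⟨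
            1 * List.length (assignments base) ∎
            where open ≤-Reasoning
          count-assignments {r} {h} ρr≤h n≤32r r≤co (add {m = m} {vs} b v v∉ j c) large = begin
            n ^ (g + jumps b) * card G                       ≡⟨ cong (_* card G) (^-distribˡ-+-* n g (jumps b)) ⟩
            n ^ g * n ^ jumps b * card G                     ≡⟨ *-assoc (n ^ g) (n ^ jumps b) (card G) ⟩
            n ^ g * (n ^ jumps b * card G)                   ≤⟨ *-monoʳ-≤ (n ^ g) (count-assignments ρr≤h n≤32r r≤co b (m+n≤o⇒n≤o _ large)) ⟩
            n ^ g * (loss b * List.length (assignments b))   ≡⟨ swap (n ^ g) (loss b) _ ⟩
            loss b * (n ^ g * List.length (assignments b))   ≤⟨ *-monoʳ-≤ (loss b) (length-extensions (λ α → members (admissible v j α)) (n ^ g) (2 * κ) (assignments b) choices) ⟩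
            loss b * (2 * κ * L)                             ≡⟨ regroup (loss b) (2 * κ) L ⟩
            2 * κ * loss b * L ∎
            where
            open ≤-Reasoning
            g = suc (jump c)
            κ = choiceConst β g
            G = tower β F h
            L = List.length (assignments (add b v v∉ j c))
            swap : ∀ x y z → x * (y * z) ≡ y * (x * z)
            swap = solve-∀
            regroup : ∀ x y z → x * (y * z) ≡ y * x * z
            regroup = solve-∀
            choices : ∀ α → α ∈ₗ assignments b → n ^ g ≤ 2 * κ * card (admissible v j α)
            choices α α∈ = tower-ample β F (jump c) (ρ v) (lookup α j) m n≤32r r≤co
              (subst (λ k → tower β F k (lookup α j) ≡ true) (sym (jump-ρ c)) (Valid.in-tower (assignments-valid b α∈) j))
              (m+n≤o⇒m≤o _ large) α

          module _ {m} {vs : Vec V m} (b : Build vs) (all∈ : ∀ v → v ∈ᵥ vs) where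
            position : V → Fin m
            position v = proj₁ (all∈ v)

            lookup-position : ∀ v → lookup vs (position v) ≡ v
            lookup-position v = proj₂ (all∈ v)

            position-lookup : ∀ i → position (lookup vs i) ≡ i
            position-lookup i = build-injective b (lookup-position (lookup vs i))

            toCopy : ∀ {α} → Valid vs α → Copy T F
            toCopy {α} valid = record
              { emb       = place
              ; injective = λ {v} {w} eq → trans (sym (lookup-position v))
                              (trans (cong (lookup vs) (distinct eq)) (lookup-position w))
              ; monotone  = covers-monotone T E E-injective E-mono place place-covers
              ; inFamily  = λ v → tower-anti β F {0} {ρ (lookup vs (position v))} z≤n (place v) (in-tower (position v))
              }
              where
              open Valid valid
              place : V → Subset n
              place v = lookup α (position v)
              place-covers : ∀ y v → y ⋖ v → place y ⊆ place v
              place-covers y v c with above-parent (position v)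
              ... | inj₁ v≡r = ⊥-elim (root-minimal (subst (y ⋖_) (trans (sym (lookup-position v)) v≡r) c))
              ... | inj₂ (j , c′ , ⊆′) = subst (λ i → lookup α i ⊆ place v) (sym y≡) ⊆′
                where
                y≡ : position y ≡ j
                y≡ = trans (cong position (upward v y (lookup vs j) c (subst (lookup vs j ⋖_) (lookup-position v) c′)))
                           (position-lookup j)

            -- All words of length `m` in the sets of `α`. They include every assignment with the
            -- same image, and there are `m ^ m` of them, whatever `α` is.
            near : Vec (Subset n) m → List (Vec (Subset n) m)
            near α = vectors m (Vec.toList α)

            SameSubfamily⇒near : ∀ {α γ} (α-valid : Valid vs α) (γ-valid : Valid vs γ) →
                                 SameSubfamily T (toCopy α-valid) (toCopy γ-valid) → γ ∈ₗ near α
            SameSubfamily⇒near {α} {γ} _ _ (_ , γ⊆α) = ∈-vectors γ entry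
              where
              lookup∈toList : ∀ {k} (ξ : Vec (Subset n) k) i → lookup ξ i ∈ₗ Vec.toList ξ
              lookup∈toList (_ ∷ ξ) zero    = here refl
              lookup∈toList (_ ∷ ξ) (suc i) = there (lookup∈toList ξ i)
              entry : ∀ i → lookup γ i ∈ₗ Vec.toList α
              entry i with γ⊆α (lookup vs i)
              ... | p , eq = subst (_∈ₗ Vec.toList α)
                               (sym (trans (cong (lookup γ) (sym (position-lookup i))) eq))
                               (lookup∈toList α (position p))

            distinct-copies : ∃ λ M → List.length (assignments b) ≤ suc (m ^ m) * M × AtLeastCopies T F M
            distinct-copies with thin (Vec.≡-dec (Vec.≡-dec Bool._≟_)) near (m ^ m)
              (λ α → ≤-reflexive (trans (length-vectors m (Vec.toList α)) (cong (_^ m) (Vec.length-toList α))))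
              (assignments b) (assignments-unique b)
            ... | αs , count , apart , αs⊆ = List.length αs , count , copies , differ
              where
              valid : ∀ i → Valid vs (List.lookup αs i)
              valid i = assignments-valid b (αs⊆ (∈-lookup i))
              copies : Fin (List.length αs) → Copy T F
              copies i = toCopy (valid i)
              differ : ∀ i j → i ≢ j → ¬ SameSubfamily T (copies i) (copies j)
              differ i j i≢j same@(i⊆j , j⊆i) with Fin.<-cmp i j
              ... | tri< i<j _ _ = AllPairs-lookup apart i<j (SameSubfamily⇒near (valid i) (valid j) same)
              ... | tri≈ _ i≡j _ = i≢j i≡j
              ... | tri> _ _ j<i = AllPairs-lookup apart j<i (SameSubfamily⇒near (valid j) (valid i) (j⊆i , i⊆j))

  -- Supersaturation from a model copy

  -- The surplus over `h` middle levels is `N / k`. Deleting the high sets costs at most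
  -- `N / (4 * k)`, and the `h` rounds cost `h * N / B` beyond `h * N`, again at most `N / (4 * k)`
  -- for `B = 4 * k * suc h`. Half of the surplus survives.
  tower-large : ∀ {k h N cF c₀ t cG} .{{_ : NonZero k}} → (k * h + 1) * N ≤ k * cF → cF ≤ c₀ + t → 4 * k * t ≤ N →
                (4 * k * suc h) * c₀ ≤ h * (suc (4 * k * suc h) * N) + (4 * k * suc h) * cG → N ≤ 2 * k * cG
  tower-large {k} {h} {N} {cF} {c₀} {t} {cG} large split tail c₀≤ =
    *-cancelˡ-≤ (2 * B) {{m*n≢0 2 B}} (+-cancelˡ-≤ (2 * B * N + 4 * k * h * B * N) _ _ (begin
      2 * B * N + 4 * k * h * B * N + 2 * B * N                     ≡⟨ lhs k h N B ⟩
      4 * B * ((k * h + 1) * N)                                     ≤⟨ *-monoʳ-≤ (4 * B) (≤-trans large (*-monoʳ-≤ k split)) ⟩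
      4 * B * (k * (c₀ + t))                                        ≡⟨ expand B k c₀ t ⟩
      4 * k * (B * c₀) + B * (4 * k * t)                            ≤⟨ +-mono-≤ (*-monoʳ-≤ (4 * k) c₀≤) (*-monoʳ-≤ B tail) ⟩
      4 * k * (h * (suc B * N) + B * cG) + B * N                    ≡⟨ collect k h B N cG ⟩
      4 * k * h * B * N + B * N + 4 * k * h * N + 2 * B * (2 * k * cG)
        ≤⟨ +-monoˡ-≤ (2 * B * (2 * k * cG)) (+-monoʳ-≤ (4 * k * h * B * N + B * N) (*-monoˡ-≤ N (*-monoʳ-≤ (4 * k) (n≤1+n h)))) ⟩
      4 * k * h * B * N + B * N + B * N + 2 * B * (2 * k * cG)      ≡⟨ rhs (4 * k * h * B * N) B N (2 * B * (2 * k * cG)) ⟩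
      2 * B * N + 4 * k * h * B * N + 2 * B * (2 * k * cG) ∎))
    where
    open ≤-Reasoning
    B = 4 * k * suc h
    instance
      4k≢0 : NonZero (4 * k)
      4k≢0 = m*n≢0 4 k
      B≢0 : NonZero B
      B≢0 = m*n≢0 (4 * k) (suc h)
    lhs : ∀ k h N B → 2 * B * N + 4 * k * h * B * N + 2 * B * N ≡ 4 * B * ((k * h + 1) * N)
    lhs = solve-∀
    expand : ∀ B k c t → 4 * B * (k * (c + t)) ≡ 4 * k * (B * c) + B * (4 * k * t)
    expand = solve-∀
    collect : ∀ k h B N c → 4 * k * (h * (suc B * N) + B * c) + B * N ≡
                            4 * k * h * B * N + B * N + 4 * k * h * N + 2 * B * (2 * k * c)
    collect = solve-∀
    rhs : ∀ x B N y → x + B * N + B * N + y ≡ 2 * B * N + x + y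
    rhs = solve-∀

  n≤32*[n/16] : ∀ n → 16 ≤ n → n ≤ 32 * (n / 16)
  n≤32*[n/16] n 16≤n = begin
    n                               ≡⟨ m≡m%n+[m/n]*n n 16 ⟩
    n % 16 + n / 16 * 16            ≤⟨ +-monoˡ-≤ (n / 16 * 16) (<⇒≤ (m%n<n n 16)) ⟩
    16 + n / 16 * 16                ≤⟨ +-monoˡ-≤ (n / 16 * 16) (*-monoˡ-≤ 16 (/-monoˡ-≤ 16 16≤n)) ⟩
    n / 16 * 16 + n / 16 * 16       ≡⟨ *-distribˡ-+ (n / 16) 16 16 ⟨
    n / 16 * 32                     ≡⟨ *-comm (n / 16) 32 ⟩
    32 * (n / 16) ∎
    where open ≤-Reasoning

  -- The theorem over the natural numbers: `1 / k` stands for ε, `1 / suc K` for δ, and `h` for the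
  -- height minus one.
  Supersaturated : FinPoset → ℕ → ℕ → Set
  Supersaturated T h x = ∀ k .{{_ : NonZero k}} → ∃₂ λ K n₀ → ∀ n → n₀ ≤ n → (F : Family n) →
    (k * h + 1) * central n ≤ k * card F → ∃ λ M → n ^ x * central n ≤ suc K * M × AtLeastCopies T F M

  mapCopies : ∀ {T T′ n} {F F′ : Family n} (φ : Copy T F → Copy T′ F′) →
              (∀ c d → SameSubfamily T′ (φ c) (φ d) → SameSubfamily T c d) →
              ∀ {M} → AtLeastCopies T F M → AtLeastCopies T′ F′ M
  mapCopies φ reflect (cs , distinct) = φ ∘ cs , λ i j i≢j same → distinct i j i≢j (reflect (cs i) (cs j) same)

  weaken : ∀ {T n} {F F′ : Family n} (c : Copy T F) → (∀ v → F′ (emb c v) ≡ true) → Copy T F′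
  weaken c F′∋ = record { emb = emb c ; injective = injective c ; monotone = monotone c ; inFamily = F′∋ }

  module _ (T : FinPoset) (connected : HasseConnected T) (upward : UpwardMonotone T)
           (v₀ : Fin (FinPoset.size T)) where
    open FinPoset T
    open Embedding T connected upward v₀

    -- The exponent is the sum of the jumps of the model `E`. It is returned together with
    -- `Between E g`, from which it follows that `g` is at least the spread of the model.
    supersaturation : ∀ {n₁} (E : Fin size → Subset n₁) → Injective _≡_ _≡_ E → (∀ p q → p ≼ q → E p ⊆ E q) →
                      (ρ : Fin size → ℕ) (c₀ : ℕ) → (∀ v → ∣ E v ∣ + ρ v ≡ c₀) →
                      ∀ {h} → (∀ v → ρ v ≤ h) → ∃ λ g → Between E g × Supersaturated T h g
    supersaturation E E-inj E-mono ρ c₀ ∣E∣+ρ {h} ρ≤h with build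
    ... | m , vs , b , all∈ = g , E-between E E-inj E-mono ρ c₀ ∣E∣+ρ b all∈ , abundant
      where
      g = jumps E E-inj E-mono ρ c₀ ∣E∣+ρ b
      abundant : Supersaturated T h g
      abundant k = 2 * k * (ℓ * suc (m ^ m)) , n₁ ⊔ (θ ⊔ 16) , bound
        where
        B = 4 * k * suc h
        ℓ = loss E E-inj E-mono ρ c₀ ∣E∣+ρ (suc B) b
        θ = threshold E E-inj E-mono ρ c₀ ∣E∣+ρ (suc B) b
        n₁ = proj₁ (high-negligible (4 * k))
        bound : ∀ n → n₁ ⊔ (θ ⊔ 16) ≤ n → (F : Family n) → (k * h + 1) * central n ≤ k * card F →
                ∃ λ M → n ^ g * central n ≤ suc (2 * k * (ℓ * suc (m ^ m))) * M × AtLeastCopies T F M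
        bound n n₀≤n F large = M , final , mapCopies lower (λ _ _ → id) (proj₂ (proj₂ dc))
          where
          open ≤-Reasoning
          r = n / 16
          -- Only members with at least n/16 missing elements are kept, as the count of members
          -- above a set requires.
          F₀ : Family n
          F₀ X = F X ∧ (r ≤ᵇ co X)
          lower : Copy T F₀ → Copy T F
          lower c = weaken c (λ v → proj₁ (∧-true (inFamily c v)))
          dc = distinct-copies E E-inj E-mono ρ c₀ ∣E∣+ρ (suc B) F₀ b all∈
          M = proj₁ dc
          A = List.length (assignments E E-inj E-mono ρ c₀ ∣E∣+ρ (suc B) F₀ b)
          cG = card (tower (suc B) F₀ h)
          split : card F ≤ card F₀ + card (high {n} r)
          split = begin
            card F                                                ≡⟨ card≡∑ F ⟩
            ∑ (λ X → ⟦ F X ⟧)                                     ≤⟨ ∑-mono pointwise ⟩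
            ∑ (λ X → ⟦ F₀ X ⟧ + ⟦ high {n} r X ⟧)                 ≡⟨ ∑-+ (λ X → ⟦ F₀ X ⟧) _ ⟩
            ∑ (λ X → ⟦ F₀ X ⟧) + ∑ (λ X → ⟦ high {n} r X ⟧)       ≡⟨ cong₂ _+_ (card≡∑ F₀) (card≡∑ (high {n} r)) ⟨
            card F₀ + card (high {n} r) ∎
            where
            pointwise : ∀ X → ⟦ F X ⟧ ≤ ⟦ F₀ X ⟧ + ⟦ high {n} r X ⟧
            pointwise X with F X | r ≤ᵇ co X
            ... | false | _     = z≤n
            ... | true  | true  = ≤-refl
            ... | true  | false = ≤-refl
          N≤ : central n ≤ 2 * k * cG
          N≤ = tower-large {k} {h} large split (proj₂ (high-negligible (4 * k)) n (m⊔n≤o⇒m≤o n₁ _ n₀≤n)) (card-tower B F₀ h)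
          r≤co : ∀ H → F₀ H ≡ true → r ≤ co H
          r≤co H H∈ = ≤ᵇ-true (proj₂ (∧-true {F H} H∈))
          counted : n ^ g * cG ≤ ℓ * A
          counted = count-assignments E E-inj E-mono ρ c₀ ∣E∣+ρ (suc B) F₀ (ρ≤h _)
            (n≤32*[n/16] n (m⊔n≤o⇒n≤o θ 16 (m⊔n≤o⇒n≤o n₁ _ n₀≤n))) r≤co b
            (m⊔n≤o⇒m≤o θ 16 (m⊔n≤o⇒n≤o n₁ _ n₀≤n))
          swap : ∀ x y z → x * (y * z) ≡ y * (x * z)
          swap = solve-∀
          regroup : ∀ x y z w → x * (y * (z * w)) ≡ x * (y * z) * w
          regroup = solve-∀
          final : n ^ g * central n ≤ suc (2 * k * (ℓ * suc (m ^ m))) * M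
          final = begin
            n ^ g * central n                        ≤⟨ *-monoʳ-≤ (n ^ g) N≤ ⟩
            n ^ g * (2 * k * cG)                     ≡⟨ swap (n ^ g) (2 * k) cG ⟩
            2 * k * (n ^ g * cG)                     ≤⟨ *-monoʳ-≤ (2 * k) (≤-trans counted (*-monoʳ-≤ ℓ (proj₁ (proj₂ dc)))) ⟩
            2 * k * (ℓ * (suc (m ^ m) * M))          ≡⟨ regroup (2 * k) ℓ (suc (m ^ m)) M ⟩
            2 * k * (ℓ * suc (m ^ m)) * M            ≤⟨ m≤n+m _ M ⟩
            suc (2 * k * (ℓ * suc (m ^ m))) * M ∎

  -- Duality

  levels⁺ : ∀ {n i m} (X : Subset n) → i < ∣ X ∣ → ∣ X ∣ ≤ i + m → levels n i m X ≡ true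
  levels⁺ X i< ≤i+m = cong₂ _∧_ (≤⇒≤ᵇ-true i<) (≤⇒≤ᵇ-true ≤i+m)

  levels⁻ : ∀ {n i m} (X : Subset n) → levels n i m X ≡ true → i < ∣ X ∣ × ∣ X ∣ ≤ i + m
  levels⁻ {i = i} X X∈ with ∧-true {suc i ≤ᵇ ∣ X ∣} X∈
  ... | i< , ≤i+m = ≤ᵇ-true i< , ≤ᵇ-true ≤i+m

  op : FinPoset → FinPoset
  op T = record { size = size ; _≼_ = flip _≼_ ; isPartialOrder = Flip.isPartialOrder isPartialOrder }
    where open FinPoset T

  Covers-op : ∀ T {p q} → Covers (op T) p q → Covers T q p
  Covers-op T ((q≼p , p≢q) , between) =
    (q≼p , p≢q ∘ sym) , λ { (z , (q≼z , q≢z) , (z≼p , z≢p)) → between (z , (z≼p , z≢p ∘ sym) , (q≼z , q≢z ∘ sym)) }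

  op-connected : ∀ T → HasseConnected T → HasseConnected (op T)
  op-connected T connected p q = Star.map adj (connected p q)
    where
    adj : ∀ {p q} → HasseAdj T p q → HasseAdj (op T) p q
    adj (inj₁ c) = inj₂ (Covers-op (op T) c)
    adj (inj₂ c) = inj₁ (Covers-op (op T) c)

  op-upward : ∀ T → DownwardMonotone T → UpwardMonotone (op T)
  op-upward T downward x y y′ c c′ = downward x y y′ (Covers-op T c) (Covers-op T c′)

  op-height : ∀ T {h} → IsHeight T h → IsHeight (op T) h
  op-height T ((c , c-inj , comparable) , largest) =
    (c , c-inj , λ i j → Sum.swap (comparable i j)) ,
    λ { m (c′ , c′-inj , comparable′) → largest m (c′ , c′-inj , λ i j → Sum.swap (comparable′ i j)) }

  ∁-involutive : ∀ {n} (X : Subset n) → ∁ (∁ X) ≡ X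
  ∁-involutive X = ⊆-antisym (λ x∈ → x∉∁p⇒x∈p (x∈∁p⇒x∉p x∈)) (λ x∈ → x∉p⇒x∈∁p (x∈p⇒x∉∁p x∈))

  complementCopy : ∀ {T n} {F F′ : Family n} (c : Copy (op T) F) → (∀ X → F X ≡ true → F′ (∁ X) ≡ true) → Copy T F′
  complementCopy c F′∋ = record
    { emb       = ∁ ∘ emb c
    ; injective = injective c ∘ ∁-injective
    ; monotone  = λ p q p≼q → p⊆q⇒∁p⊇∁q (monotone c q p p≼q)
    ; inFamily  = λ v → F′∋ (emb c v) (inFamily c v) }

  complementCopy-op : ∀ {T n} {F F′ : Family n} (c : Copy T F) → (∀ X → F X ≡ true → F′ (∁ X) ≡ true) → Copy (op T) F′
  complementCopy-op c F′∋ = record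
    { emb       = ∁ ∘ emb c
    ; injective = injective c ∘ ∁-injective
    ; monotone  = λ p q q≼p → p⊆q⇒∁p⊇∁q (monotone c q p q≼p)
    ; inFamily  = λ v → F′∋ (emb c v) (inFamily c v) }

  card-∁ : ∀ {n} (F : Family n) → card (F ∘ ∁) ≡ card F
  card-∁ F = trans (card≡∑ (F ∘ ∁)) (trans (∑-∁ (λ X → ⟦ F X ⟧)) (sym (card≡∑ F)))
    where
    ∑-∁ : ∀ {n} (f : Subset n → ℕ) → ∑ (f ∘ ∁) ≡ ∑ f
    ∑-∁ {zero}  f = refl
    ∑-∁ {suc n} f = trans (cong₂ _+_ (∑-∁ (f ∘ (false ∷_))) (∑-∁ (f ∘ (true ∷_)))) (+-comm (∑ (f ∘ (false ∷_))) _)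

  Supersaturated-op : ∀ {T h x} → Supersaturated (op T) h x → Supersaturated T h x
  Supersaturated-op {T} abundant k with abundant k
  ... | K , n₀ , bound = K , n₀ , λ n n₀≤n F large →
    let M , M≥ , copies = bound n n₀≤n (F ∘ ∁) (≤-trans large (≤-reflexive (cong (k *_) (sym (card-∁ F)))))
    in M , M≥ , mapCopies {op T} {T} (λ c → complementCopy {T} c (λ X X∈ → X∈))
      (λ c d (c⊆d , d⊆c) → (λ p → let q , eq = c⊆d p in q , ∁-injective eq) ,
                           (λ q → let p , eq = d⊆c q in p , ∁-injective eq)) copies

  weaken-exponent : ∀ {T h x g} → x ≤ g → Supersaturated T h g → Supersaturated T h x
  weaken-exponent {x = x} {g} x≤g abundant k with abundant k
  ... | K , n₀ , bound = K , n₀ ⊔ 1 , λ n n₀≤n F large →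
    let M , M≥ , copies = bound n (m⊔n≤o⇒m≤o n₀ 1 n₀≤n) F large
    in M , ≤-trans (*-monoˡ-≤ (central n) (^-monoʳ-≤ n {{>-nonZero (m⊔n≤o⇒n≤o n₀ 1 n₀≤n)}} x≤g)) M≥ , copies

  -- The given copy only supplies the sizes that bound the refinement of p ≼ q into covering relations.
  downsets : ∀ T → HasseConnected T → UpwardMonotone T → Fin (FinPoset.size T) → ∀ {h} → IsHeight T h →
             ∀ {n} {F : Family n} → Copy T F → Copy T (levels (suc (FinPoset.size T)) 0 h)
  downsets T connected upward v₀ height c = record
    { emb       = downset
    ; injective = downset-injective
    ; monotone  = covers-monotone T (emb c) (injective c) (monotone c) downset downset-covers
    ; inFamily  = λ v → levels⁺ (downset v) (∣downset∣>0 v) (∣downset∣≤ height v) }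
    where open UpwardTree T connected upward v₀

  -- If h were at most e, the copy in `h` consecutive levels would also lie in `e` consecutive
  -- levels, which are free of T.
  height>e : ∀ T {h e n i} → IsE T e → Copy T (levels n i h) → e < h
  height>e T {h} {e} {n} {i} (free , _) c = ≰⇒> λ h≤e → free n i (weaken c λ v →
    let i< , ≤i+h = levels⁻ (emb c v) (inFamily c v) in levels⁺ (emb c v) i< (≤-trans ≤i+h (+-monoʳ-≤ i h≤e)))

  upward-case : ∀ T → HasseConnected T → UpwardMonotone T → Fin (FinPoset.size T) →
                ∀ {h e x} → IsHeight T h → IsE T e → IsX T e x → 0 < h × Supersaturated T (pred h) x
  -- One cube, of dimension `n₀`, already supplies a model of spread x; the model then governs the
  -- embedding for every n.
  upward-case T connected upward v₀ {h} {e} {x} height isE (n₀ , largest) with largest n₀ ≤-refl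
  ... | (c , spread≡x) , _ = ≤-trans (s≤s z≤n) e<h , weaken-exponent {T} (≤-trans (≤-reflexive (sym spread≡x)) (spread≤ c between)) abundant
    where
    e<h = height>e T isE (downsets T connected upward v₀ height c)
    i = ⌊ n₀ ∸ suc e /2⌋
    -- Measured down from the highest of the `suc e` middle levels. The lowest has size `suc i`, so
    -- the distance is at most `e`.
    ρ : Fin (FinPoset.size T) → ℕ
    ρ v = (i + suc e) ∸ ∣ emb c v ∣
    ρ≤ : ∀ v → ρ v ≤ pred h
    ρ≤ v = ≤-trans (m≤n+o⇒m∸n≤o (i + suc e) _ (≤-trans (≤-reflexive (+-suc i e))
      (+-monoˡ-≤ e (proj₁ (levels⁻ (emb c v) (inFamily c v)))))) (<⇒≤pred e<h)
    result = supersaturation T connected upward v₀ (emb c) (injective c) (monotone c) ρ (i + suc e)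
      (λ v → m+[n∸m]≡n (proj₂ (levels⁻ (emb c v) (inFamily c v)))) ρ≤
    between = proj₁ (proj₂ result)
    abundant = proj₂ (proj₂ result)

  downward-case : ∀ T → HasseConnected T → DownwardMonotone T → Fin (FinPoset.size T) →
                  ∀ {h e x} → IsHeight T h → IsE T e → IsX T e x → 0 < h × Supersaturated T (pred h) x
  downward-case T connected downward v₀ {h} {e} {x} height isE (n₀ , largest) with largest n₀ ≤-refl
  ... | (c , spread≡x) , _ = ≤-trans (s≤s z≤n) e<h ,
    Supersaturated-op {T} {pred h} {x} (weaken-exponent {op T} (≤-trans (≤-reflexive (sym spread≡x)) (spread≤ c (Between-∁ (emb c) between))) abundant)
    where
    open ≤-Reasoning
    s₀ = FinPoset.size T
    connected′ = op-connected T connected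
    upward′ = op-upward T downward
    c∁ : Copy (op T) (middleLevels n₀ (suc e) ∘ ∁)
    c∁ = complementCopy-op c λ X X∈ → trans (cong (middleLevels n₀ (suc e)) (∁-involutive X)) X∈
    h≤s₀ : h ≤ s₀
    h≤s₀ = let chain , chain-inj , _ = proj₁ height in Fin.injective⇒≤ chain-inj
    -- Sizes 1 to h in a ground set of `suc s₀` elements become the sizes from `suc (s₀ - h)` to
    -- `s₀` of the complements: again `h` consecutive levels.
    upsets : Copy T (levels (suc s₀) (s₀ ∸ h) h)
    upsets = complementCopy {T} (downsets (op T) connected′ upward′ v₀ (op-height T height) c∁) λ X X∈ →
      let 0< , ≤h = levels⁻ {i = 0} X X∈ in
      levels⁺ (∁ X)
        (begin
          suc (s₀ ∸ h)    ≡⟨ +-∸-assoc 1 h≤s₀ ⟨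
          suc s₀ ∸ h      ≤⟨ ∸-monoʳ-≤ (suc s₀) ≤h ⟩
          suc s₀ ∸ ∣ X ∣  ≡⟨ ∣∁p∣≡n∸∣p∣ X ⟨
          ∣ ∁ X ∣ ∎)
        (begin
          ∣ ∁ X ∣        ≡⟨ ∣∁p∣≡n∸∣p∣ X ⟩
          suc s₀ ∸ ∣ X ∣  ≤⟨ ∸-monoʳ-≤ (suc s₀) 0< ⟩
          s₀              ≡⟨ m∸n+n≡m h≤s₀ ⟨
          s₀ ∸ h + h ∎)
    e<h = height>e T isE upsets
    i = ⌊ n₀ ∸ suc e /2⌋
    -- Complementation reverses the levels, so the distance is now measured up from the lowest
    -- middle level, of size `suc i`.
    ρ : Fin s₀ → ℕ
    ρ v = ∣ emb c v ∣ ∸ suc i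
    ρ≤ : ∀ v → ρ v ≤ pred h
    ρ≤ v = ≤-trans (m≤n+o⇒m∸n≤o _ (suc i) (≤-trans (proj₂ (levels⁻ (emb c v) (inFamily c v)))
      (≤-reflexive (+-suc i e)))) (<⇒≤pred e<h)
    ∣∁∣+ρ : ∀ v → ∣ ∁ (emb c v) ∣ + ρ v ≡ n₀ ∸ suc i
    ∣∁∣+ρ v = begin-equality
      ∣ ∁ (emb c v) ∣ + ρ v                              ≡⟨ cong (_+ ρ v) (∣∁p∣≡n∸∣p∣ (emb c v)) ⟩
      n₀ ∸ ∣ emb c v ∣ + (∣ emb c v ∣ ∸ suc i)           ≡⟨ +-∸-assoc (n₀ ∸ ∣ emb c v ∣) (proj₁ (levels⁻ (emb c v) (inFamily c v))) ⟨
      n₀ ∸ ∣ emb c v ∣ + ∣ emb c v ∣ ∸ suc i             ≡⟨ cong (_∸ suc i) (m∸n+n≡m (∣p∣≤n (emb c v))) ⟩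
      n₀ ∸ suc i ∎
    result = supersaturation (op T) connected′ upward′ v₀ (emb c∁) (injective c∁) (monotone c∁) ρ (n₀ ∸ suc i) ∣∁∣+ρ ρ≤
    between = proj₁ (proj₂ result)
    abundant = proj₂ (proj₂ result)

  monotone-case : ∀ T → IsTreePoset T → Monotone T →
                  ∀ {h e x} → IsHeight T h → IsE T e → IsX T e x → 0 < h × Supersaturated T (pred h) x
  monotone-case T (size>0 , connected , _) (inj₁ upward)   = upward-case T connected upward (Fin.fromℕ< size>0)
  monotone-case T (size>0 , connected , _) (inj₂ downward) = downward-case T connected downward (Fin.fromℕ< size>0)

-- Passage between natural and rational numbers

open Counting using (central; monotone-case)
open import Data.Nat using (ℕ; _^_; ⌊_/2⌋; suc; zero) renaming (_≤_ to _≤ℕ_)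
open import Data.Rational using (ℚ; 0ℚ; 1ℚ; _<_; _≤_; _+_; _-_; _*_; toℚᵘ; mkℚ; *<*; NonNegative)
open import Data.Rational.Solver using (module +-*-Solver)


ℕ→ℚᵘ : ℕ → ℚᵘ.ℚᵘ
ℕ→ℚᵘ m = ℚᵘ.mkℚᵘ (ℤ.+ m) 0

toℚᵘ-ℕ : ∀ m → toℚᵘ (ℕ→ℚ m) ℚᵘ.≃ ℕ→ℚᵘ m
toℚᵘ-ℕ m = ℚ.toℚᵘ-fromℚᵘ (ℕ→ℚᵘ m)

ℕ→ℚ-* : ∀ a b → ℕ→ℚ (a ℕ.* b) ≡ ℕ→ℚ a * ℕ→ℚ b
ℕ→ℚ-* a b = ℚ.toℚᵘ-injective (begin-equality
  toℚᵘ (ℕ→ℚ (a ℕ.* b))               ≃⟨ toℚᵘ-ℕ (a ℕ.* b) ⟩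
  ℕ→ℚᵘ (a ℕ.* b)                     ≡⟨ cong (λ z → ℚᵘ.mkℚᵘ z 0) (ℤ.pos-* a b) ⟩
  ℕ→ℚᵘ a ℚᵘ.* ℕ→ℚᵘ b                 ≃⟨ ℚᵘ.*-cong (toℚᵘ-ℕ a) (toℚᵘ-ℕ b) ⟨
  toℚᵘ (ℕ→ℚ a) ℚᵘ.* toℚᵘ (ℕ→ℚ b)     ≃⟨ ℚ.toℚᵘ-homo-* (ℕ→ℚ a) (ℕ→ℚ b) ⟨
  toℚᵘ (ℕ→ℚ a * ℕ→ℚ b) ∎)
  where open ℚᵘ.≤-Reasoning

ℕ→ℚ-+ : ∀ a b → ℕ→ℚ (a ℕ.+ b) ≡ ℕ→ℚ a + ℕ→ℚ b
ℕ→ℚ-+ a b = ℚ.toℚᵘ-injective (begin-equality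
  toℚᵘ (ℕ→ℚ (a ℕ.+ b))               ≃⟨ toℚᵘ-ℕ (a ℕ.+ b) ⟩
  ℕ→ℚᵘ (a ℕ.+ b)                     ≡⟨ cong (λ z → ℚᵘ.mkℚᵘ z 0) (cong₂ ℤ._+_ (ℤ.*-identityʳ (ℤ.+ a)) (ℤ.*-identityʳ (ℤ.+ b))) ⟨
  ℕ→ℚᵘ a ℚᵘ.+ ℕ→ℚᵘ b                 ≃⟨ ℚᵘ.+-cong (toℚᵘ-ℕ a) (toℚᵘ-ℕ b) ⟨
  toℚᵘ (ℕ→ℚ a) ℚᵘ.+ toℚᵘ (ℕ→ℚ b)     ≃⟨ ℚ.toℚᵘ-homo-+ (ℕ→ℚ a) (ℕ→ℚ b) ⟨
  toℚᵘ (ℕ→ℚ a + ℕ→ℚ b) ∎)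
  where open ℚᵘ.≤-Reasoning

ℕ→ℚ-mono : ∀ {a b} → a ≤ℕ b → ℕ→ℚ a ≤ ℕ→ℚ b
ℕ→ℚ-mono {a} {b} a≤b = ℚ.toℚᵘ-cancel-≤ (begin
  toℚᵘ (ℕ→ℚ a)   ≃⟨ toℚᵘ-ℕ a ⟩
  ℕ→ℚᵘ a         ≤⟨ ℚᵘ.*≤* (ℤ.*-monoʳ-≤-nonNeg (ℤ.+ 1) (ℤ.+≤+ a≤b)) ⟩
  ℕ→ℚᵘ b         ≃⟨ toℚᵘ-ℕ b ⟨
  toℚᵘ (ℕ→ℚ b) ∎)
  where open ℚᵘ.≤-Reasoning

ℕ→ℚ-cancel : ∀ {a b} → ℕ→ℚ a ≤ ℕ→ℚ b → a ≤ℕ b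
ℕ→ℚ-cancel {a} {b} le = ℤ.drop‿+≤+ (ℤ.*-cancelʳ-≤-pos (ℤ.+ a) (ℤ.+ b) (ℤ.+ 1) (ℚᵘ.drop-*≤* (begin
  ℕ→ℚᵘ a         ≃⟨ toℚᵘ-ℕ a ⟨
  toℚᵘ (ℕ→ℚ a)   ≤⟨ ℚ.toℚᵘ-mono-≤ le ⟩
  toℚᵘ (ℕ→ℚ b)   ≃⟨ toℚᵘ-ℕ b ⟩
  ℕ→ℚᵘ b ∎)))
  where open ℚᵘ.≤-Reasoning

-- A positive rational times its denominator is its numerator, a positive integer; so the
-- denominator serves as the multiplier.
archimedean : ∀ ε → 0ℚ < ε → ∃ λ d → 1ℚ ≤ ℕ→ℚ (suc d) * ε
archimedean ε@(mkℚ (ℤ.+ suc p) d _) _ = d , ℚ.toℚᵘ-cancel-≤ (begin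
  ℕ→ℚᵘ 1                                        ≤⟨ ℚᵘ.*≤* (ℤ.+≤+ bound) ⟩
  ℕ→ℚᵘ (suc d) ℚᵘ.* ℚᵘ.mkℚᵘ (ℤ.+ suc p) d       ≃⟨ ℚᵘ.*-cong (toℚᵘ-ℕ (suc d)) (ℚᵘ.≃-refl {ℚᵘ.mkℚᵘ (ℤ.+ suc p) d}) ⟨
  toℚᵘ (ℕ→ℚ (suc d)) ℚᵘ.* toℚᵘ ε                ≃⟨ ℚ.toℚᵘ-homo-* (ℕ→ℚ (suc d)) ε ⟨
  toℚᵘ (ℕ→ℚ (suc d) * ε) ∎)
  where
  open ℚᵘ.≤-Reasoning
  bound : 1 ℕ.* (1 ℕ.* suc d) ≤ℕ suc d ℕ.* suc p ℕ.* 1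
  bound = ℕ.≤-trans (ℕ.≤-reflexive (trans (ℕ.*-identityˡ _) (ℕ.*-identityˡ (suc d))))
          (ℕ.≤-trans (ℕ.m≤m*n (suc d) (suc p)) (ℕ.≤-reflexive (sym (ℕ.*-identityʳ _))))
archimedean (mkℚ (ℤ.+ zero) d _)     (*<* (ℤ.+<+ ()))
archimedean (mkℚ ℤ.-[1+ p ] d _)     (*<* ())

unitFraction : ℕ → ℚ
unitFraction K = ℤ.+ 1 ℚ./ suc K

unitFraction-* : ∀ K → unitFraction K * ℕ→ℚ (suc K) ≡ 1ℚ
unitFraction-* K = ℚ.toℚᵘ-injective (begin-equality
  toℚᵘ (unitFraction K * ℕ→ℚ (suc K))             ≃⟨ ℚ.toℚᵘ-homo-* (unitFraction K) (ℕ→ℚ (suc K)) ⟩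
  toℚᵘ (unitFraction K) ℚᵘ.* toℚᵘ (ℕ→ℚ (suc K))   ≃⟨ ℚᵘ.*-cong (ℚ.toℚᵘ-fromℚᵘ (ℚᵘ.mkℚᵘ (ℤ.+ 1) K)) (toℚᵘ-ℕ (suc K)) ⟩
  ℚᵘ.mkℚᵘ (ℤ.+ 1) K ℚᵘ.* ℕ→ℚᵘ (suc K)             ≃⟨ ℚᵘ.*≡* (cong ℤ.+_ (units K)) ⟩
  ℕ→ℚᵘ 1 ∎)
  where
  open ℚᵘ.≤-Reasoning
  units : ∀ K → 1 ℕ.* suc K ℕ.* 1 ≡ 1 ℕ.* (suc K ℕ.* 1)
  units K = ℕ.*-assoc 1 (suc K) 1

ℕ→ℚ-nonNeg : ∀ m → NonNegative (ℕ→ℚ m)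
ℕ→ℚ-nonNeg m = ℚ.normalize-nonNeg m 1

theorem1p6 : (T : FinPoset) → IsTreePoset T → Monotone T →
    (h e x : ℕ) → IsHeight T h → IsE T e → IsX T e x →
    (ε : ℚ) → 0ℚ < ε →
    Σ ℚ λ δ → 0ℚ < δ × ∃ λ n₀ → ∀ n → n₀ ≤ℕ n →
    (F : Family n) →
    (ℕ→ℚ h - 1ℚ + ε) * ℕ→ℚ (n C ⌊ n /2⌋) ≤ ℕ→ℚ (card F) →
    ∃ λ M → δ * ℕ→ℚ (n ^ x) * ℕ→ℚ (n C ⌊ n /2⌋) ≤ ℕ→ℚ M × AtLeastCopies T F M
theorem1p6 T tree mono (suc h) e x height isE isX ε ε>0 with archimedean ε ε>0 | monotone-case T tree mono height isE isX
... | d , 1≤kε | _ , abundant with abundant (suc d)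
... | K , n₀ , bound = unitFraction K , ℚ.positive⁻¹ _ {{ℚ.normalize-pos 1 (suc K)}} , n₀ , copies
  where
  k = suc d
  copies : ∀ n → n₀ ≤ℕ n → (F : Family n) →
    (ℕ→ℚ (suc h) - 1ℚ + ε) * ℕ→ℚ (central n) ≤ ℕ→ℚ (card F) →
    ∃ λ M → unitFraction K * ℕ→ℚ (n ^ x) * ℕ→ℚ (central n) ≤ ℕ→ℚ M × AtLeastCopies T F M
  copies n n₀≤n F large = M , lower , proj₂ (proj₂ result)
    where
    open ℚ.≤-Reasoning
    open +-*-Solver
    N = ℕ→ℚ (central n)
    -- Scaling the hypothesis by `k`, which satisfies `k * ε ≥ 1`, replaces ε by the integer 1.
    large′ : (k ℕ.* h ℕ.+ 1) ℕ.* central n ≤ℕ k ℕ.* card F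
    large′ = ℕ→ℚ-cancel (begin
      ℕ→ℚ ((k ℕ.* h ℕ.+ 1) ℕ.* central n)            ≡⟨ trans (ℕ→ℚ-* (k ℕ.* h ℕ.+ 1) (central n)) (cong (_* N) (trans (ℕ→ℚ-+ (k ℕ.* h) 1) (cong (_+ 1ℚ) (ℕ→ℚ-* k h)))) ⟩
      (ℕ→ℚ k * ℕ→ℚ h + 1ℚ) * N                      ≤⟨ ℚ.*-monoʳ-≤-nonNeg N {{ℕ→ℚ-nonNeg (central n)}} (ℚ.+-monoʳ-≤ (ℕ→ℚ k * ℕ→ℚ h) 1≤kε) ⟩
      (ℕ→ℚ k * ℕ→ℚ h + ℕ→ℚ k * ε) * N               ≡⟨ solve 4 (λ k h ε N → (k :* h :+ k :* ε) :* N := k :* ((con 1ℚ :+ h :- con 1ℚ :+ ε) :* N)) refl (ℕ→ℚ k) (ℕ→ℚ h) ε N ⟩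
      ℕ→ℚ k * ((1ℚ + ℕ→ℚ h - 1ℚ + ε) * N)           ≡⟨ cong (λ z → ℕ→ℚ k * ((z - 1ℚ + ε) * N)) (ℕ→ℚ-+ 1 h) ⟨
      ℕ→ℚ k * ((ℕ→ℚ (suc h) - 1ℚ + ε) * N)          ≤⟨ ℚ.*-monoˡ-≤-nonNeg (ℕ→ℚ k) {{ℕ→ℚ-nonNeg k}} large ⟩
      ℕ→ℚ k * ℕ→ℚ (card F)                           ≡⟨ ℕ→ℚ-* k (card F) ⟨
      ℕ→ℚ (k ℕ.* card F) ∎)
    result = bound n n₀≤n F large′
    M = proj₁ result
    δ = unitFraction K
    lower : δ * ℕ→ℚ (n ^ x) * N ≤ ℕ→ℚ M
    lower = begin
      δ * ℕ→ℚ (n ^ x) * N                   ≡⟨ ℚ.*-assoc δ (ℕ→ℚ (n ^ x)) N ⟩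
      δ * (ℕ→ℚ (n ^ x) * N)                 ≡⟨ cong (δ *_) (ℕ→ℚ-* (n ^ x) (central n)) ⟨
      δ * ℕ→ℚ (n ^ x ℕ.* central n)         ≤⟨ ℚ.*-monoˡ-≤-nonNeg δ {{ℚ.normalize-nonNeg 1 (suc K)}} (ℕ→ℚ-mono (proj₁ (proj₂ result))) ⟩
      δ * ℕ→ℚ (suc K ℕ.* M)                 ≡⟨ cong (δ *_) (ℕ→ℚ-* (suc K) M) ⟩
      δ * (ℕ→ℚ (suc K) * ℕ→ℚ M)             ≡⟨ ℚ.*-assoc δ (ℕ→ℚ (suc K)) (ℕ→ℚ M) ⟨
      δ * ℕ→ℚ (suc K) * ℕ→ℚ M               ≡⟨ cong (_* ℕ→ℚ M) (unitFraction-* K) ⟩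
      1ℚ * ℕ→ℚ M                            ≡⟨ ℚ.*-identityˡ (ℕ→ℚ M) ⟩
      ℕ→ℚ M ∎
-- Height 0 is impossible, since the height exceeds e.
theorem1p6 T tree mono zero e x height isE isX _ _ with proj₁ (monotone-case T tree mono height isE isX)
... | ()
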